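{- Let $v, w \in \mathbb{R}^n$ where $v$ has pairwise distinct coordinates. Then \[ \mathcal{O}(v,w) := \#\{\sigma \in S_n : w \cdot \sigma v = 0\} \leq \operatorname{comp}(w)!\, M\!\left(\begin{bmatrix} n \\ \operatorname{comp}(w)\end{bmatrix}_q\right). \]
   Context: A permutation $\sigma \in S_n$ acts on $v \in \mathbb{R}^n$ by $\sigma v = (v_{\sigma^{ -1}(1)}, \ldots, v_{\sigma^{ -1}(n)})$; $\cdot$ is the standard dot product. A composition of $n$ is a sequence $\alpha=(\alpha_1,\ldots,\alpha_m)$ of positive integers summing to $n$, and $\alpha! := \prod_i \alpha_i!$. For $w \in \mathbb{R}^n$, let $w'$ be its weakly increasing rearrangement; there are unique $0=a_0<a_1<\cdots<a_m=n$ such that $w'$ is constant on each block $\{a_j+1,\ldots,a_{j+1}\}$ and strictly increases between consecutive blocks, and $\operatorname{comp}(w) := (a_1-a_0,\ldots,a_m-a_{m-1})$. The $q$-multinomial coefficient is $\begin{bmatrix} n \\ \alpha\end{bmatrix}_q = \frac{[n]_q!}{[\alpha_1]_q!\cdots[\alpha_m]_q!}$ with $[n]_q = 1+q+\cdots+q^{n-1}$, $[n]_q! = [1]_q\cdots[n]_q$. For a polynomial $f$, $M(f)$ denotes its largest coefficient. -}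

module Defs where

open import Level using (Level; 0ℓ) renaming (suc to lsuc)
open import Data.Nat as ℕ using (ℕ; zero; suc)
open import Data.Nat using (_!)
open import Data.Integer as ℤ using (ℤ; +_)
open import Data.Fin using (Fin)
open import Data.Fin.Permutation as Perm using (Permutation′; _⟨$⟩ˡ_)
open import Data.List using (List; []; _∷_; map; replicate; foldr; length)
open import Data.List.Relation.Unary.All using (All)
open import Data.List.Relation.Unary.AllPairs using (AllPairs)
open import Data.Vec.Functional using (toList)
open import Data.Product using (Σ)
open import Relation.Nullary using (¬_)
open import Relation.Binary.PropositionalEquality using (_≡_)
open import Relation.Binary.Definitions using (tri<; tri≈; tri>)
open import Relation.Binary.Structures using (IsStrictTotalOrder)
open import Algebra.Structures using (IsCommutativeRing)

-- Linearly ordered fields (ℝ is the intended instance; stdlib has no ℝ)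

record OrderedField (c : Level) : Set (lsuc c) where
  infixl 6 _+_
  infixl 7 _*_
  infix 4 _<_
  field
    Carrier : Set c
    _+_ _*_ : Carrier → Carrier → Carrier
    -_      : Carrier → Carrier
    0# 1#   : Carrier
    _<_     : Carrier → Carrier → Set c
    isCommutativeRing  : IsCommutativeRing _≡_ _+_ _*_ -_ 0# 1#
    isStrictTotalOrder : IsStrictTotalOrder _≡_ _<_
    +-mono-<  : ∀ {a b} c → a < b → a + c < b + c
    *-pos     : ∀ {a b} → 0# < a → 0# < b → 0# < a * b
    0<1       : 0# < 1#
    inverse   : ∀ a → ¬ (a ≡ 0#) → Σ Carrier (λ b → a * b ≡ 1#)

  open IsStrictTotalOrder isStrictTotalOrder public using (compare)

module _ {c} (F : OrderedField c) where
  open OrderedField F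

  ∑ : ∀ {n} → (Fin n → Carrier) → Carrier
  ∑ {zero}  f = 0#
  ∑ {suc n} f = f Fin.zero + ∑ (λ i → f (Fin.suc i))
    where import Data.Fin as Fin

  dot : ∀ {n} → (Fin n → Carrier) → (Fin n → Carrier) → Carrier
  dot x y = ∑ (λ i → x i * y i)

  insert : Carrier → List Carrier → List Carrier
  insert x [] = x ∷ []
  insert x (y ∷ ys) with compare x y
  ... | tri< _ _ _ = x ∷ y ∷ ys
  ... | tri≈ _ _ _ = x ∷ y ∷ ys
  ... | tri> _ _ _ = y ∷ insert x ys

  sortL : List Carrier → List Carrier
  sortL [] = []
  sortL (x ∷ xs) = insert x (sortL xs)

  runsFrom : Carrier → ℕ → List Carrier → List ℕ
  runsFrom x k [] = k ∷ []
  runsFrom x k (y ∷ ys) with compare x y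
  ... | tri≈ _ _ _ = runsFrom x (suc k) ys
  ... | tri< _ _ _ = k ∷ runsFrom y 1 ys
  ... | tri> _ _ _ = k ∷ runsFrom y 1 ys

  runs : List Carrier → List ℕ
  runs [] = []
  runs (x ∷ xs) = runsFrom x 1 xs

  comp : ∀ {n} → (Fin n → Carrier) → List ℕ
  comp w = runs (sortL (toList w))

  act : ∀ {n} → Permutation′ n → (Fin n → Carrier) → (Fin n → Carrier)
  act σ v i = v (σ ⟨$⟩ˡ i)

compFact : List ℕ → ℕ
compFact α = foldr (λ a r → (a !) ℕ.* r) 1 α

-- Polynomials in q with integer coefficients: coefficient lists,
-- i-th entry = coefficient of q^i.

Poly : Set
Poly = List ℤ

coeff : Poly → ℕ → ℤ
coeff [] k = + 0
coeff (a ∷ p) zero = a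
coeff (a ∷ p) (suc k) = coeff p k

_+ₚ_ : Poly → Poly → Poly
[] +ₚ q = q
(a ∷ p) +ₚ [] = a ∷ p
(a ∷ p) +ₚ (b ∷ q) = (a ℤ.+ b) ∷ (p +ₚ q)

_*ₚ_ : Poly → Poly → Poly
[] *ₚ q = []
(a ∷ p) *ₚ q = map (a ℤ.*_) q +ₚ (+ 0 ∷ (p *ₚ q))

_≈ₚ_ : Poly → Poly → Set
p ≈ₚ q = ∀ k → coeff p k ≡ coeff q k

oneₚ : Poly
oneₚ = + 1 ∷ []

qInt : ℕ → Poly
qInt k = replicate k (+ 1)

qFact : ℕ → Poly
qFact zero = oneₚ
qFact (suc k) = qFact k *ₚ qInt (suc k)

qCompFact : List ℕ → Poly
qCompFact α = foldr (λ a r → qFact a *ₚ r) oneₚ α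

IsQMultinomial : ℕ → List ℕ → Poly → Set
IsQMultinomial n α P = (P *ₚ qCompFact α) ≈ₚ qFact n

M : Poly → ℤ
M [] = + 0
M (a ∷ p) = foldr ℤ._⊔_ a p

{-# OPTIONS --safe #-}

-- Only the words x = w ∘ σ matter: each arises from comp(w)! permutations, and its dot product with the
-- increasing rearrangement of v is strictly increasing along the covers "exchange two letters that are
-- adjacent in the subword of the letters ≥ a, one of them being a".  Splitting off the letter a identifies
-- the words with tuples of 0/1 patterns.  Spanned by the patterns with a zeros and b ones is an exterior
-- power of an irreducible representation of sl₂, so that sl₂ acts on the functions on words, with raising
-- operator E supported on the covers and with weight 2 rank − top.  Let X be the set of words with dot
-- product 0.  A function φ supported on the words with dot product ≥ 0 has Eφ supported on those with dot
-- product > 0.  So if X were larger than the middle rank, then by counting equations some φ ≠ 0 would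
-- satisfy Eφ = 0 and ∑ₖ Fᵏφ = 0 on the middle rank; but highest weight vectors are determined by that
-- sum.  The size of the middle rank is a coefficient of the q-multinomial, which is the rank
-- generating function of the words.
module Submission where

open import Defs
open import Level using (Level)
open import Data.Nat using (ℕ)
open import Data.Integer using (ℤ; +_; _≤_; _*_)
open import Data.Fin using (Fin)
open import Data.Fin.Permutation using (Permutation′; _≈_)
open import Data.List using (List; length)
open import Data.List.Relation.Unary.All using (All)
open import Data.List.Relation.Unary.AllPairs using (AllPairs)
open import Relation.Nullary using (¬_)
open import Relation.Binary.PropositionalEquality using (_≡_)

open import Algebra.Bundles using (CommutativeMonoid; CommutativeRing)
open import Algebra.Structures using (IsCommutativeMonoid)
import Algebra.Properties.CommutativeSemigroup as CommutativeSemigroupProperties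
open import Data.Empty using (⊥)
open import Data.Fin using (zero; suc; punchIn)
import Data.Fin.Properties as Fin
open import Data.Fin.Permutation using (_⟨$⟩ˡ_; _⟨$⟩ʳ_; inverseˡ; inverseʳ)
open import Data.Integer as ℤ using (_+_; -_; _-_)
import Data.Integer.Properties as ℤ
open import Data.Integer.Tactic.RingSolver using (solve-∀)
open import Algebra.Properties.AbelianGroup ℤ.+-0-abelianGroup using () renaming (∙-cancelʳ to +-cancelʳ)
open import Algebra.Properties.Semiring.Sum ℤ.+-*-semiring using (sum-cong-≗; sum-remove; ∑-distrib-+; *-distribˡ-sum; sum-replicate-zero) renaming (sum to sumℤ)
open import Data.List using ([]; _∷_; _++_; cartesianProduct; cartesianProductWith; concatMap; filter; foldr; lookup; map; replicate)
open import Data.List.Properties using (filter-accept; filter-reject; length-++; length-map; length-tabulate; ∷-injectiveˡ; ∷-injectiveʳ)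
open import Data.List.Membership.Propositional using (_∈_)
open import Data.List.Membership.Propositional.Properties using (∈-++⁺ˡ; ∈-++⁺ʳ; ∈-++⁻; ∈-cartesianProduct⁺; ∈-cartesianProductWith⁺; ∈-concatMap⁺; ∈-filter⁺; ∈-lookup; ∈-map⁺; ∈-map⁻; ∈-tabulate⁺; ∈-tabulate⁻; ∈-∃++)
open import Data.List.Membership.Propositional.Properties.WithK using (unique∧set⇒bag)
open import Data.List.Relation.Binary.BagAndSetEquality using (∼bag⇒↭)
open import Data.List.Relation.Binary.Permutation.Propositional using (_↭_; ↭-sym; ↭-trans; refl; prep; swap; ↭⇒↭ₛ) renaming (trans to _⨾_)
open import Data.List.Relation.Binary.Permutation.Propositional.Properties as ↭ using (↭-length; ↭-empty-inv; ∈-resp-↭; All-resp-↭; drop-∷)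
import Data.List.Relation.Binary.Permutation.Setoid.Properties as ↭ₛ
open import Data.List.Relation.Unary.All as All using ([]; _∷_)
import Data.List.Relation.Unary.All.Properties as All
open import Data.List.Relation.Unary.AllPairs as AllPairs using ([]; _∷_)
import Data.List.Relation.Unary.AllPairs.Properties as AllPairs
open import Data.List.Relation.Unary.Any as Any using (here; there)
open import Data.List.Relation.Unary.Any.Properties using (lookup-index)
open import Data.List.Relation.Unary.Unique.Propositional using (Unique)
import Data.List.Relation.Unary.Unique.Propositional.Properties as Unique
open import Data.Nat as ℕ using (zero; suc; _!)
open import Data.Nat.ListAction using (sum)
import Data.Nat.Properties as ℕ
open import Data.Product using (Σ; ∃; ∃₂; _×_; _,_; proj₁; proj₂; map₁; map₂)
open import Data.Sum using (_⊎_; inj₁; inj₂)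
open import Data.Unit using (⊤; tt)
open import Data.Vec using (Vec; []; _∷_)
open import Data.Vec.Functional using (insertAt; toList)
open import Data.Vec.Functional.Properties using (insertAt-lookup; insertAt-punchIn)
open import Data.Vec.Relation.Unary.All as VecAll using ([]; _∷_)
open import Function using (_∘_; id)
open import Function.Bundles using (mk⇔)
open import Relation.Binary.Bundles using (Setoid)
open import Relation.Binary.Definitions using (tri<; tri≈; tri>)
open import Relation.Binary.PropositionalEquality using (_≢_; refl; sym; trans; cong; cong₂; subst; subst₂; setoid; module ≡-Reasoning)
import Relation.Binary.Reasoning.Setoid as SetoidReasoning
open import Relation.Binary.Structures using (IsStrictTotalOrder)
open import Relation.Nullary using (Dec; yes; no; contradiction)
open import Relation.Nullary.Decidable using (¬?; decidable-stable)

-- Integer linear systems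

-- The words with dot product 0 form an antichain, and the bound on their number is a Sperner
-- property. The signs of the dot products do not respect the grading by rank, so φ cannot be taken
-- homogeneous. The sum over `k` copes with this: `F^k` brings rank m + k down to rank m, so all
-- ranks from the middle on are tested at once, with only one equation per word of the middle rank.
-- The count of the remaining equations: a word with negative dot product contributes φ = 0, one
-- with positive dot product Eφ = 0, and one with dot product 0 nothing, since Eφ vanishes there
-- already. The exterior powers show no signs: replacing a basis vector by its neighbour either
-- repeats a factor, which gives zero, or keeps the order of the factors. The basis of the
-- irreducible representation of dimension n is scaled so that all entries of E are 1; the
-- commutation relation then forces the entries j (n - j) of F. All entries are integers, so the
-- linear algebra stays over `ℤ`.

*-≢0 : ∀ {a b : ℤ} → a ≢ + 0 → b ≢ + 0 → a * b ≢ + 0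
*-≢0 {a} a≢0 b≢0 ab≡0 with ℤ.i*j≡0⇒i≡0∨j≡0 a ab≡0
... | inj₁ a≡0 = a≢0 a≡0
... | inj₂ b≡0 = b≢0 b≡0

*-cancel-0 : ∀ {a b : ℤ} → a ≢ + 0 → a * b ≡ + 0 → b ≡ + 0
*-cancel-0 {a} a≢0 ab≡0 with ℤ.i*j≡0⇒i≡0∨j≡0 a ab≡0
... | inj₁ a≡0 = contradiction a≡0 a≢0
... | inj₂ b≡0 = b≡0

sum-zero : ∀ {n} (t : Fin n → ℤ) → (∀ i → t i ≡ + 0) → sumℤ t ≡ + 0
sum-zero {n} t t≡0 = trans (sum-cong-≗ t≡0) (sum-replicate-zero n)

-- Fraction-free elimination of the pivot column j of the first row.
kernel : ∀ {m n} → m ℕ.< n → (R : Fin m → Fin n → ℤ) →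
         ∃ λ (x : Fin n → ℤ) → (∃ λ j → x j ≢ + 0) × (∀ i → sumℤ (λ j → R i j * x j) ≡ + 0)
kernel {zero} {suc n} _ R = (λ _ → + 1) , (zero , λ ()) , λ ()
kernel {suc m} {suc n} (ℕ.s≤s m<n) R with Fin.any? (λ j → ¬? (R zero j ℤ.≟ + 0))
... | no ∄pivot with kernel (ℕ.m<n⇒m<1+n m<n) (R ∘ suc)
...   | x , x≢0 , Rx≡0 = x , x≢0 , λ where
          zero    → sum-zero _ λ j → cong (_* x j) (decidable-stable (R zero j ℤ.≟ + 0) λ r≢0 → ∄pivot (j , r≢0))
          (suc i) → Rx≡0 i
kernel {suc m} {suc n} (ℕ.s≤s m<n) R | yes (j , p≢0)
  with kernel m<n (λ i k → R zero j * R (suc i) (punchIn j k) - R (suc i) j * R zero (punchIn j k))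
... | y , (k , yk≢0) , eq = x , (punchIn j k , xk≢0) , rows
  where
  p s : ℤ
  p = R zero j
  s = sumℤ (λ k → R zero (punchIn j k) * y k)
  x : Fin (suc n) → ℤ
  x = insertAt (λ k → p * y k) j (- s)
  xk≢0 : x (punchIn j k) ≢ + 0
  xk≢0 xk≡0 = *-≢0 p≢0 yk≢0 (trans (sym (insertAt-punchIn _ j (- s) k)) xk≡0)
  row : ∀ i → sumℤ (λ j → R i j * x j) ≡ R i j * (- s) + p * sumℤ (λ k → R i (punchIn j k) * y k)
  row i = begin
    sumℤ (λ j → R i j * x j)
      ≡⟨ sum-remove {i = j} (λ j → R i j * x j) ⟩
    R i j * x j + sumℤ (λ k → R i (punchIn j k) * x (punchIn j k))
      ≡⟨ cong₂ _+_ (cong (R i j *_) (insertAt-lookup _ j (- s)))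
           (sum-cong-≗ λ k → trans (cong (R i (punchIn j k) *_) (insertAt-punchIn _ j (- s) k))
             (commute (R i (punchIn j k)) p (y k))) ⟩
    R i j * (- s) + sumℤ (λ k → p * (R i (punchIn j k) * y k))
      ≡⟨ cong (λ z → R i j * (- s) + z) (*-distribˡ-sum {n} p _) ⟨
    R i j * (- s) + p * sumℤ (λ k → R i (punchIn j k) * y k) ∎
    where
    open ≡-Reasoning
    commute : ∀ a b c → a * (b * c) ≡ b * (a * c)
    commute = solve-∀
  rows : ∀ i → sumℤ (λ j → R i j * x j) ≡ + 0
  rows zero = trans (row zero) (cancel p s)
    where
    cancel : ∀ p s → p * (- s) + p * s ≡ + 0
    cancel = solve-∀
  rows (suc i) = begin
    sumℤ (λ j → R (suc i) j * x j)
      ≡⟨ row (suc i) ⟩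
    a * (- s) + p * sumℤ (λ k → R (suc i) (punchIn j k) * y k)
      ≡⟨ cong₂ _+_ (trans (flip a s) (*-distribˡ-sum {n} (- a) _)) (*-distribˡ-sum {n} p _) ⟩
    sumℤ (λ k → (- a) * (R zero (punchIn j k) * y k)) + sumℤ (λ k → p * (R (suc i) (punchIn j k) * y k))
      ≡⟨ ∑-distrib-+ {n} _ _ ⟨
    sumℤ (λ k → (- a) * (R zero (punchIn j k) * y k) + p * (R (suc i) (punchIn j k) * y k))
      ≡⟨ sum-cong-≗ (λ k → collect a p (R zero (punchIn j k)) (R (suc i) (punchIn j k)) (y k)) ⟩
    sumℤ (λ k → (p * R (suc i) (punchIn j k) - a * R zero (punchIn j k)) * y k)
      ≡⟨ eq i ⟩
    + 0 ∎
    where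
    open ≡-Reasoning
    a = R (suc i) j
    flip : ∀ a s → a * (- s) ≡ (- a) * s
    flip = solve-∀
    collect : ∀ a p q r y → (- a) * (q * y) + p * (r * y) ≡ (p * r - a * q) * y
    collect = solve-∀

-- A formal sum serves both as the row of an operator at a point and as a linear equation on
-- functions, so that a condition such as Eφ = 0 at `x` is literally the equation `down x`.
Comb : Set → Set
Comb B = List (ℤ × B)

eval : ∀ {B} → Comb B → (B → ℤ) → ℤ
eval []            φ = + 0
eval ((c , y) ∷ l) φ = c * φ y + eval l φ

unit : ∀ {n} → Fin n → Fin n → ℤ
unit zero    zero    = + 1
unit zero    (suc j) = + 0
unit (suc i) zero    = + 0
unit (suc i) (suc j) = unit i j

sum-unit : ∀ {n} (i : Fin n) (x : Fin n → ℤ) → sumℤ (λ j → unit i j * x j) ≡ x i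
sum-unit zero x = trans (cong₂ _+_ (ℤ.*-identityˡ (x zero)) (sum-zero (λ j → + 0 * x (suc j)) λ _ → refl)) (ℤ.+-identityʳ (x zero))
sum-unit (suc i) x = trans (ℤ.+-identityˡ _) (sum-unit i (x ∘ suc))

lookup-injective : ∀ {a} {A : Set a} {xs : List A} → Unique xs → ∀ {i j} → lookup xs i ≡ lookup xs j → i ≡ j
lookup-injective (_ ∷ _)  {zero}  {zero}  _  = refl
lookup-injective (d ∷ _)  {zero}  {suc j} eq = contradiction eq (All.lookup d (∈-lookup j))
lookup-injective (d ∷ _)  {suc i} {zero}  eq = contradiction (sym eq) (All.lookup d (∈-lookup i))
lookup-injective (_ ∷ us) {suc i} {suc j} eq = cong suc (lookup-injective us eq)

module _ {B : Set} {xs : List B} (unique : Unique xs) (complete : ∀ b → b ∈ xs) where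

  private
    index : B → Fin (length xs)
    index b = Any.index (complete b)

    index-lookup : ∀ j → index (lookup xs j) ≡ j
    index-lookup j = lookup-injective unique (sym (lookup-index (complete (lookup xs j))))

    row : Comb B → Fin (length xs) → ℤ
    row l j = eval l (λ b → unit (index b) j)

    row-sum : ∀ l x → sumℤ (λ j → row l j * x j) ≡ eval l (x ∘ index)
    row-sum [] x = sum-zero (λ j → + 0 * x j) λ _ → refl
    row-sum ((c , y) ∷ l) x = begin
      sumℤ (λ j → (c * unit (index y) j + row l j) * x j)
        ≡⟨ sum-cong-≗ (λ j → expand c (unit (index y) j) (row l j) (x j)) ⟩
      sumℤ (λ j → c * (unit (index y) j * x j) + row l j * x j)
        ≡⟨ ∑-distrib-+ {length xs} _ _ ⟩
      sumℤ (λ j → c * (unit (index y) j * x j)) + sumℤ (λ j → row l j * x j)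
        ≡⟨ cong₂ _+_ (trans (sym (*-distribˡ-sum {length xs} c _)) (cong (c *_) (sum-unit (index y) x))) (row-sum l x) ⟩
      c * x (index y) + eval l (x ∘ index) ∎
      where
      open ≡-Reasoning
      expand : ∀ c u r x → (c * u + r) * x ≡ c * (u * x) + r * x
      expand = solve-∀

  -- Functions on `B` become vectors indexed by positions in `xs`. A non-zero vector stays non-zero
  -- as a function because every position is the index of some point, and this rests on `unique`.
  comb-kernel : (es : List (Comb B)) → length es ℕ.< length xs →
                ∃ λ (φ : B → ℤ) → (∃ λ b → φ b ≢ + 0) × (∀ {e} → e ∈ es → eval e φ ≡ + 0)
  comb-kernel es lt with kernel lt (λ i → row (lookup es i))
  ... | x , (j , xj≢0) , Rx≡0 =
    x ∘ index
    , (lookup xs j , λ eq → xj≢0 (trans (sym (cong x (index-lookup j))) eq))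
    , λ {e} e∈ → trans (sym (row-sum e x))
        (subst (λ e → sumℤ (λ j → row e j * x j) ≡ + 0) (sym (lookup-index e∈)) (Rx≡0 (Any.index e∈)))

-- Representations of sl₂ on functions

module _ {B : Set} where

  Over : ∀ {p} → (B → Set p) → Comb B → Set p
  Over P = All (P ∘ proj₂)

  eval-cong : ∀ {φ ψ : B → ℤ} {l} → Over (λ y → φ y ≡ ψ y) l → eval l φ ≡ eval l ψ
  eval-cong []                        = refl
  eval-cong {l = (c , _) ∷ _} (e ∷ es) = cong₂ (λ a b → c * a + b) e (eval-cong es)

  eval-ext : ∀ {φ ψ : B → ℤ} → (∀ y → φ y ≡ ψ y) → ∀ l → eval l φ ≡ eval l ψ
  eval-ext eq l = eval-cong (All.universal (eq ∘ proj₂) l)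

  eval-zero : ∀ {φ : B → ℤ} {l} → Over (λ y → φ y ≡ + 0) l → eval l φ ≡ + 0
  eval-zero []                        = refl
  eval-zero {φ} {(c , y) ∷ l} (e ∷ es) =
    cong₂ _+_ (trans (cong (c *_) e) (ℤ.*-zeroʳ c)) (eval-zero es)

  eval-+ : ∀ l (φ ψ : B → ℤ) → eval l (λ y → φ y + ψ y) ≡ eval l φ + eval l ψ
  eval-+ []            φ ψ = refl
  eval-+ ((c , y) ∷ l) φ ψ =
    trans (cong (λ z → c * (φ y + ψ y) + z) (eval-+ l φ ψ)) (lemma c (φ y) (ψ y) _ _)
    where
    lemma : ∀ c a b x y → c * (a + b) + (x + y) ≡ (c * a + x) + (c * b + y)
    lemma = solve-∀

  eval-* : ∀ l a (φ : B → ℤ) → eval l (λ y → a * φ y) ≡ a * eval l φ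
  eval-* []            a φ = sym (ℤ.*-zeroʳ a)
  eval-* ((c , y) ∷ l) a φ =
    trans (cong (λ z → c * (a * φ y) + z) (eval-* l a φ)) (lemma c a (φ y) _)
    where
    lemma : ∀ c a b x → c * (a * b) + a * x ≡ a * (c * b + x)
    lemma = solve-∀

  eval-++ : ∀ l l′ (φ : B → ℤ) → eval (l ++ l′) φ ≡ eval l φ + eval l′ φ
  eval-++ []            l′ φ = sym (ℤ.+-identityˡ _)
  eval-++ ((c , y) ∷ l) l′ φ = trans (cong (λ z → c * φ y + z) (eval-++ l l′ φ)) (sym (ℤ.+-assoc (c * φ y) _ _))

  scale : ℤ → Comb B → Comb B
  scale a = map (map₁ (a *_))

  eval-scale : ∀ a l (φ : B → ℤ) → eval (scale a l) φ ≡ a * eval l φ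
  eval-scale a []            φ = sym (ℤ.*-zeroʳ a)
  eval-scale a ((c , y) ∷ l) φ =
    trans (cong (λ z → a * c * φ y + z) (eval-scale a l φ)) (lemma a c (φ y) _)
    where
    lemma : ∀ a c b x → a * c * b + a * x ≡ a * (c * b + x)
    lemma = solve-∀

  bind : Comb B → (B → Comb B) → Comb B
  bind []            g = []
  bind ((c , y) ∷ l) g = scale c (g y) ++ bind l g

  eval-bind : ∀ l g (φ : B → ℤ) → eval (bind l g) φ ≡ eval l (λ y → eval (g y) φ)
  eval-bind []            g φ = refl
  eval-bind ((c , y) ∷ l) g φ =
    trans (eval-++ (scale c (g y)) (bind l g) φ) (cong₂ _+_ (eval-scale c (g y) φ) (eval-bind l g φ))

cmap : ∀ {B B′ : Set} → (B → B′) → Comb B → Comb B′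
cmap f = map (map₂ f)

eval-cmap : ∀ {B B′ : Set} (f : B → B′) l φ → eval (cmap f l) φ ≡ eval l (φ ∘ f)
eval-cmap f []            φ = refl
eval-cmap f ((c , y) ∷ l) φ = cong (λ z → c * φ (f y) + z) (eval-cmap f l φ)

eval-comm : ∀ {B B′ : Set} (l : Comb B) (l′ : Comb B′) (φ : B → B′ → ℤ) →
            eval l (λ x → eval l′ (φ x)) ≡ eval l′ (λ y → eval l (λ x → φ x y))
eval-comm []            l′ φ = sym (eval-zero (All.universal (λ _ → refl) l′))
eval-comm ((c , x) ∷ l) l′ φ = begin
  c * eval l′ (φ x) + eval l (λ x → eval l′ (φ x))
    ≡⟨ cong₂ _+_ (sym (eval-* l′ c (φ x))) (eval-comm l l′ φ) ⟩
  eval l′ (λ y → c * φ x y) + eval l′ (λ y → eval l (λ x → φ x y))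
    ≡⟨ eval-+ l′ _ _ ⟨
  eval l′ (λ y → c * φ x y + eval l (λ x → φ x y)) ∎
  where open ≡-Reasoning

-- A representation of sl₂ on the functions B → ℤ: E = eval (down _) raises and F = eval (up _) lowers
-- the rank of the support.
record Rep (B : Set) : Set where
  field
    down up    : B → Comb B
    rank       : B → ℕ
    top        : ℕ
    elems      : List B
    unique     : Unique elems
    complete   : ∀ x → x ∈ elems
    rank-≤     : ∀ x → rank x ℕ.≤ top
    down-rank  : ∀ x → Over (λ y → suc (rank y) ≡ rank x) (down x)
    up-rank    : ∀ x → Over (λ y → rank y ≡ suc (rank x)) (up x)

  weight : B → ℤ
  weight x = + 2 * + rank x - + top

  field
    commutator : ∀ φ x → eval (down x) (λ y → eval (up y) φ)
                       ≡ eval (up x) (λ y → eval (down y) φ) + weight x * φ x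

-- The witness is half of `n` rounded up: from this rank on weights are nonnegative, below it they
-- are negative. The two ranges need different arguments in `kernel-injective`.
∃-middle : ∀ n → ∃ λ m → n ℕ.≤ 2 ℕ.* m × (∀ {r} → r ℕ.< m → 2 ℕ.* r ℕ.< n)
∃-middle zero = 0 , ℕ.z≤n , λ ()
∃-middle (suc zero) = 1 , ℕ.s≤s ℕ.z≤n , λ { (ℕ.s≤s ℕ.z≤n) → ℕ.s≤s ℕ.z≤n }
∃-middle (suc (suc n)) with ∃-middle n
... | m , n≤2m , below =
  suc m , subst (suc (suc n) ℕ.≤_) (sym (ℕ.*-suc 2 m)) (ℕ.s≤s (ℕ.s≤s n≤2m)) , below′
  where
  below′ : ∀ {r} → r ℕ.< suc m → 2 ℕ.* r ℕ.< suc (suc n)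
  below′ {zero}  _           = ℕ.s≤s ℕ.z≤n
  below′ {suc r} (ℕ.s≤s r<m) = subst (ℕ._< suc (suc n)) (sym (ℕ.*-suc 2 r)) (ℕ.s≤s (ℕ.s≤s (below r<m)))

data Sign : Set where
  neg null pos : Sign

_≟ₛ_ : (s t : Sign) → Dec (s ≡ t)
neg  ≟ₛ neg  = yes refl
neg  ≟ₛ null = no λ ()
neg  ≟ₛ pos  = no λ ()
null ≟ₛ neg  = no λ ()
null ≟ₛ null = yes refl
null ≟ₛ pos  = no λ ()
pos  ≟ₛ neg  = no λ ()
pos  ≟ₛ null = no λ ()
pos  ≟ₛ pos  = yes refl

module SL₂ {B : Set} (V : Rep B) where
  open Rep V public

  weight-up : ∀ {x y} → rank y ≡ suc (rank x) → weight y ≡ weight x + + 2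
  weight-up {x} eq = trans (cong (λ r → + 2 * + r - + top) eq) (lemma (+ rank x) (+ top))
    where
    lemma : ∀ r t → + 2 * (+ 1 + r) - t ≡ (+ 2 * r - t) + + 2
    lemma = solve-∀

  pow : ℕ → (B → ℤ) → B → ℤ
  pow zero    φ x = φ x
  pow (suc k) φ x = eval (up x) (pow k φ)

  pow-vanishes : ∀ {φ} k x → (∀ y → rank y ≡ k ℕ.+ rank x → φ y ≡ + 0) → pow k φ x ≡ + 0
  pow-vanishes zero    x φ≡0 = φ≡0 x refl
  pow-vanishes (suc k) x φ≡0 = eval-zero (All.map
    (λ {(_ , y)} ry → pow-vanishes k y λ z rz →
      φ≡0 z (trans rz (trans (cong (k ℕ.+_) ry) (ℕ.+-suc k _))))
    (up-rank x))

  -- Only the coefficients 1 matter in the end. Arbitrary ones are carried because E turns such a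
  -- sum into a shorter one with other coefficients.
  trace : ℕ → (ℕ → ℤ) → (B → ℤ) → B → ℤ
  trace zero    a φ x = a 0 * φ x
  trace (suc K) a φ x = trace K a φ x + a (suc K) * pow (suc K) φ x

  trace-head : ∀ K a {φ} x → (∀ k → k ℕ.< K → pow (suc k) φ x ≡ + 0) → trace K a φ x ≡ a 0 * φ x
  trace-head zero    a x _ = refl
  trace-head (suc K) a x v = trans
    (cong₂ _+_ (trace-head K a x λ k k<K → v k (ℕ.m<n⇒m<1+n k<K))
               (trans (cong (a (suc K) *_) (v K (ℕ.n<1+n K))) (ℤ.*-zeroʳ (a (suc K)))))
    (ℤ.+-identityʳ _)

  -- `comb-kernel` takes equations as data, so the powers of F and their sum are also needed as
  -- formal sums.
  powᶜ : ℕ → B → Comb B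
  powᶜ zero    z = (+ 1 , z) ∷ []
  powᶜ (suc k) z = bind (up z) (powᶜ k)

  eval-powᶜ : ∀ k z φ → eval (powᶜ k z) φ ≡ pow k φ z
  eval-powᶜ zero    z φ = trans (ℤ.+-identityʳ _) (ℤ.*-identityˡ _)
  eval-powᶜ (suc k) z φ = trans (eval-bind (up z) (powᶜ k) φ) (eval-ext (λ y → eval-powᶜ k y φ) (up z))

  traceᶜ : ℕ → B → Comb B
  traceᶜ zero    z = powᶜ 0 z
  traceᶜ (suc K) z = traceᶜ K z ++ powᶜ (suc K) z

  eval-traceᶜ : ∀ K z φ → eval (traceᶜ K z) φ ≡ trace K (λ _ → + 1) φ z
  eval-traceᶜ zero    z φ = ℤ.+-identityʳ _
  eval-traceᶜ (suc K) z φ = trans (eval-++ (traceᶜ K z) (powᶜ (suc K) z) φ)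
    (cong₂ _+_ (eval-traceᶜ K z φ) (trans (eval-powᶜ (suc K) z φ) (sym (ℤ.*-identityˡ _))))

  middle : ℕ
  middle = proj₁ (∃-middle top)

  module _ {φ : B → ℤ} (ker : ∀ x → eval (down x) φ ≡ + 0) where

    -- The classical formula for E applied to powers of F on a highest weight vector. As φ may mix
    -- ranks, the weight is read off at the point `x` instead of from φ. In the induction, F moves
    -- to points of weight h + 2, and (k + 1)(h + 2 + k) + h = (k + 2)(h + k + 1).
    down-pow : ∀ k x → eval (down x) (pow (suc k) φ) ≡ + suc k * (weight x + + k) * pow k φ x
    down-pow zero x = begin
      eval (down x) (pow 1 φ)
        ≡⟨ commutator φ x ⟩
      eval (up x) (λ y → eval (down y) φ) + weight x * φ x
        ≡⟨ cong (_+ weight x * φ x) (eval-zero (All.universal (ker ∘ proj₂) (up x))) ⟩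
      + 0 + weight x * φ x
        ≡⟨ lemma (weight x) (φ x) ⟩
      + 1 * (weight x + + 0) * φ x ∎
      where
      open ≡-Reasoning
      lemma : ∀ h a → + 0 + h * a ≡ + 1 * (h + + 0) * a
      lemma = solve-∀
    down-pow (suc k) x = begin
      eval (down x) (pow (suc (suc k)) φ)
        ≡⟨ commutator (pow (suc k) φ) x ⟩
      eval (up x) (λ y → eval (down y) (pow (suc k) φ)) + weight x * p
        ≡⟨ cong (_+ weight x * p) (eval-cong (All.map
             (λ {(_ , y)} ry → trans (down-pow k y)
               (cong (λ h → + suc k * (h + + k) * pow k φ y) (weight-up ry)))
             (up-rank x))) ⟩
      eval (up x) (λ y → + suc k * (weight x + + 2 + + k) * pow k φ y) + weight x * p
        ≡⟨ cong (_+ weight x * p) (eval-* (up x) (+ suc k * (weight x + + 2 + + k)) (pow k φ)) ⟩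
      + suc k * (weight x + + 2 + + k) * p + weight x * p
        ≡⟨ lemma (+ k) (weight x) p ⟩
      + suc (suc k) * (weight x + + suc k) * p ∎
      where
      open ≡-Reasoning
      p = pow (suc k) φ x
      lemma : ∀ k h p → (+ 1 + k) * (h + + 2 + k) * p + h * p ≡ (+ 2 + k) * (h + (+ 1 + k)) * p
      lemma = solve-∀

    -- By `down-pow`, a non-zero multiple of the value at `x` is a combination of values of the next
    -- power of F one rank lower. There the weight drops by 2 and `k` grows by 1, so weight + k
    -- remains negative; at rank 0 nothing lies below. With `k` = 0 this says that highest weights
    -- are nonnegative.
    vanishes-below : ∀ r x k → rank x ≡ r → weight x + + k ℤ.< + 0 → pow k φ x ≡ + 0
    vanishes-below r x k rx h<0 =
      *-cancel-0 (*-≢0 {+ suc k} (λ ()) (ℤ.<⇒≢ h<0)) (trans (sym (down-pow k x)) (eval-zero (below r rx)))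
      where
      below : ∀ r → rank x ≡ r → Over (λ y → pow (suc k) φ y ≡ + 0) (down x)
      below zero    rx = All.map (λ ry → contradiction (trans ry rx) λ ()) (down-rank x)
      below (suc r) rx = All.map (λ {(_ , y)} ry →
        vanishes-below r y (suc k) (ℕ.suc-injective (trans ry rx))
          (ℤ.≤-<-trans (ℤ.≤-trans (ℤ.i≤suc[i] _) (ℤ.≤-reflexive
            (trans (lemma (weight y) (+ k)) (cong (_+ + k) (sym (weight-up (sym ry))))))) h<0))
        (down-rank x)
        where
        lemma : ∀ h k → + 1 + (h + (+ 1 + k)) ≡ h + + 2 + k
        lemma = solve-∀

    -- E kills the term with `a 0` and lowers every other power of F by one, so the sum loses a term
    -- and the coefficients shift.
    down-trace : ∀ K a x →
      eval (down x) (trace (suc K) a φ) ≡ trace K (λ k → a (suc k) * (+ suc k * (weight x + + k))) φ x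
    down-trace zero a x = begin
      eval (down x) (trace 1 a φ)
        ≡⟨ eval-+ (down x) (λ y → a 0 * φ y) (λ y → a 1 * pow 1 φ y) ⟩
      eval (down x) (λ y → a 0 * φ y) + eval (down x) (λ y → a 1 * pow 1 φ y)
        ≡⟨ cong₂ _+_ (trans (eval-* (down x) (a 0) φ) (trans (cong (a 0 *_) (ker x)) (ℤ.*-zeroʳ (a 0))))
                     (trans (eval-* (down x) (a 1) (pow 1 φ)) (cong (a 1 *_) (down-pow 0 x))) ⟩
      + 0 + a 1 * (+ 1 * (weight x + + 0) * φ x)
        ≡⟨ lemma (a 1) (+ 1 * (weight x + + 0)) (φ x) ⟩
      a 1 * (+ 1 * (weight x + + 0)) * φ x ∎
      where
      open ≡-Reasoning
      lemma : ∀ a b c → + 0 + a * (b * c) ≡ a * b * c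
      lemma = solve-∀
    down-trace (suc K) a x = trans
      (eval-+ (down x) (trace (suc K) a φ) (λ y → a (suc (suc K)) * pow (suc (suc K)) φ y))
      (cong₂ _+_ (down-trace K a x)
        (trans (eval-* (down x) (a (suc (suc K))) (pow (suc (suc K)) φ))
          (trans (cong (a (suc (suc K)) *_) (down-pow (suc K) x))
            (sym (ℤ.*-assoc (a (suc (suc K))) _ _)))))

    -- E at rank m + 1 only reads rank m, so it gives a shorter vanishing sum at rank m + 1, and by
    -- induction φ vanishes on the ranks above m. The powers of F at rank m read only those ranks,
    -- so the original sum reduces to `a 0` times φ.
    trace-injective : ∀ K {m} a → (∀ k → a k ≢ + 0) → top ℕ.≤ 2 ℕ.* m →
                      (∀ x → rank x ≡ m → trace K a φ x ≡ + 0) →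
                      ∀ x → m ℕ.≤ rank x → rank x ℕ.≤ K ℕ.+ m → φ x ≡ + 0
    trace-injective zero a a≢0 _ tr≡0 x m≤ ≤m =
      *-cancel-0 (a≢0 0) (tr≡0 x (ℕ.≤-antisym ≤m m≤))
    trace-injective (suc K) {m} a a≢0 top≤2m tr≡0 = result
      where
      -- The weight of rank m + 1. It is at least 2 because `top` is at most 2m, so none of the new
      -- coefficients vanishes.
      h : ℤ
      h = + 2 * + suc m - + top

      a′ : ℕ → ℤ
      a′ k = a (suc k) * (+ suc k * (h + + k))

      h+k≢0 : ∀ k → h + + k ≢ + 0
      h+k≢0 k eq with ℕ.m≤n⇒∃[o]m+o≡n top≤2m
      ... | d , top+d≡2m = contradiction (trans (sym h+k≡) eq) λ ()
        where
        regroup : ∀ m t k → + 2 * (+ 1 + m) - t + k ≡ + 2 * m + (+ 2 - t + k)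
        regroup = solve-∀
        cancel : ∀ t d k → (t + d) + (+ 2 - t + k) ≡ + 2 + (d + k)
        cancel = solve-∀
        h+k≡ : h + + k ≡ + suc (suc (d ℕ.+ k))
        h+k≡ = trans (regroup (+ m) (+ top) (+ k)) (trans
          (cong (_+ (+ 2 - + top + + k)) (trans (sym (ℤ.pos-* 2 m)) (cong +_ (sym top+d≡2m))))
          (cancel (+ top) (+ d) (+ k)))

      above : ∀ x → m ℕ.< rank x → rank x ℕ.≤ suc K ℕ.+ m → φ x ≡ + 0
      above x m< ≤K+m = trace-injective K a′
        (λ k → *-≢0 (a≢0 (suc k)) (*-≢0 {+ suc k} (λ ()) (h+k≢0 k)))
        (ℕ.≤-trans top≤2m (ℕ.*-monoʳ-≤ 2 (ℕ.n≤1+n m)))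
        (λ y ry → trans (sym (subst
            (λ r → eval (down y) (trace (suc K) a φ)
                 ≡ trace K (λ k → a (suc k) * (+ suc k * (+ 2 * + r - + top + + k))) φ y)
            ry (down-trace K a y)))
          (eval-zero (All.map (λ rz → tr≡0 _ (ℕ.suc-injective (trans rz ry))) (down-rank y))))
        x m< (subst (rank x ℕ.≤_) (sym (ℕ.+-suc K m)) ≤K+m)

      result : ∀ x → m ℕ.≤ rank x → rank x ℕ.≤ suc K ℕ.+ m → φ x ≡ + 0
      result x m≤ ≤K+m with ℕ.m≤n⇒m<n∨m≡n m≤
      ... | inj₁ m<   = above x m< ≤K+m
      ... | inj₂ refl = *-cancel-0 (a≢0 0) (trans (sym (trace-head (suc K) a x λ k k<K →
              pow-vanishes (suc k) x λ y ry →
                above y (subst (rank x ℕ.<_) (sym ry) (ℕ.s≤s (ℕ.m≤n+m (rank x) k)))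
                        (subst (ℕ._≤ suc K ℕ.+ rank x) (sym ry) (ℕ.+-monoˡ-≤ (rank x) k<K))))
              (tr≡0 x refl))

    kernel-injective : (∀ z → rank z ≡ middle → trace top (λ _ → + 1) φ z ≡ + 0) → ∀ x → φ x ≡ + 0
    kernel-injective tr≡0 x with ℕ.<-≤-connex (rank x) middle
    ... | inj₂ m≤ = trace-injective top (λ _ → + 1) (λ _ ()) (proj₁ (proj₂ (∃-middle top))) tr≡0 x m≤
                      (ℕ.≤-trans (rank-≤ x) (ℕ.m≤m+n top middle))
    ... | inj₁ <m = vanishes-below (rank x) x 0 refl
      (subst (ℤ._< + 0) (sym (ℤ.+-identityʳ (weight x)))
        (subst (weight x ℤ.<_) (ℤ.+-inverseʳ (+ top)) (ℤ.+-monoˡ-< (- + top)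
          (subst (ℤ._< + top) (ℤ.pos-* 2 (rank x)) (ℤ.+<+ (proj₂ (proj₂ (∃-middle top)) <m))))))

  layer : ℕ → List B
  layer r = filter (λ x → rank x ℕ.≟ r) elems

  module _ (sign : B → Sign) (descends : ∀ x → sign x ≢ pos → Over (λ y → sign y ≡ neg) (down x)) where

    private
      -- At a `null` point the value of φ is left free, and Eφ = 0 follows from `descends` together
      -- with the equations of the `neg` points. These points are the surplus of unknowns.
      equations : Sign → B → List (Comb B)
      equations neg  x = ((+ 1 , x) ∷ []) ∷ []
      equations null x = []
      equations pos  x = down x ∷ []

      sign-equations : List B → List (Comb B)
      sign-equations = concatMap (λ x → equations (sign x) x)

      zeros : List B → List B
      zeros = filter (λ x → sign x ≟ₛ null)

      length-equations : ∀ xs → length (sign-equations xs) ℕ.+ length (zeros xs) ≡ length xs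
      length-equations []       = refl
      length-equations (x ∷ xs) with sign x
      ... | neg  = cong suc (length-equations xs)
      ... | null = trans (ℕ.+-suc _ _) (cong suc (length-equations xs))
      ... | pos  = cong suc (length-equations xs)

      system : List (Comb B)
      system = sign-equations elems ++ map (traceᶜ top) (layer middle)

      length-system : length system ≡ length (sign-equations elems) ℕ.+ length (layer middle)
      length-system = trans (length-++ (sign-equations elems))
        (cong (length (sign-equations elems) ℕ.+_) (length-map _ (layer middle)))

      system-injective : ∀ φ → (∀ {e} → e ∈ system → eval e φ ≡ + 0) → ∀ x → φ x ≡ + 0
      system-injective φ sol = kernel-injective ker λ z rz →
        trans (sym (eval-traceᶜ top z φ))
          (sol (∈-++⁺ʳ (sign-equations elems) (∈-map⁺ (traceᶜ top) (∈-filter⁺ _ (complete z) rz))))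
        where
        sol-sign : ∀ {e} x → e ∈ equations (sign x) x → eval e φ ≡ + 0
        sol-sign x e∈ = sol (∈-++⁺ˡ (∈-concatMap⁺ (λ x → equations (sign x) x) (Any.map (λ { refl → e∈ }) (complete x))))
        neg⇒0 : ∀ x → sign x ≡ neg → φ x ≡ + 0
        neg⇒0 x sx = trans (sym (trans (ℤ.+-identityʳ _) (ℤ.*-identityˡ (φ x))))
          (sol-sign x (subst (λ s → ((+ 1 , x) ∷ []) ∈ equations s x) (sym sx) (here refl)))
        nonpos : ∀ x → sign x ≢ pos → eval (down x) φ ≡ + 0
        nonpos x s≢ = eval-zero (All.map (λ {(_ , y)} → neg⇒0 y) (descends x s≢))
        ker : ∀ x → eval (down x) φ ≡ + 0
        ker x with sign x ≟ₛ pos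
        ... | yes s≡ = sol-sign x (subst (λ s → down x ∈ equations s x) (sym s≡) (here refl))
        ... | no  s≢ = nonpos x s≢

    -- Every point that is not `null` gives one equation, every point of the middle rank one more.
    -- With too many `null` points there would be fewer equations than unknowns, hence a non-zero
    -- solution, against `system-injective`.
    zeros≤layer : length (filter (λ x → sign x ≟ₛ null) elems) ℕ.≤ length (layer middle)
    zeros≤layer = ℕ.≮⇒≥ λ layer<zeros →
      let φ , (b , φb≢0) , sol = comb-kernel unique complete system
            (subst₂ ℕ._<_ (sym length-system) (length-equations elems)
              (ℕ.+-monoʳ-< (length (sign-equations elems)) layer<zeros))
      in φb≢0 (system-injective φ sol b)

-- Patterns and words

infixr 5 o∷_ i∷_

data Pat : ℕ → ℕ → Set where
  []  : Pat 0 0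
  o∷_ : ∀ {a b} → Pat a b → Pat (suc a) b
  i∷_ : ∀ {a b} → Pat a b → Pat a (suc b)

-- The number of pairs of an `o` before an `i`, the statistic whose generating function is the
-- Gaussian binomial.
patRank : ∀ {a b} → Pat a b → ℕ
patRank []               = 0
patRank (o∷_ {b = b} x) = b ℕ.+ patRank x
patRank (i∷ x)           = patRank x

-- `raise x` is the exchange of the first two letters of `o∷ x`, and `lower p x` that of `i∷ x`; the
-- leading letter is left implicit. They are the only moves that a new front letter adds.
raise : ∀ {a b} → Pat a b → Comb (Pat (suc a) b)
raise []     = []
raise (o∷ x) = []
raise (i∷ x) = (+ 1 , i∷ o∷ x) ∷ []

lower : ∀ {a b} → ℕ → Pat a b → Comb (Pat a (suc b))
lower p []                   = []
lower p (o∷_ {a} {b} x) = (+ suc p * + suc (a ℕ.+ b) , o∷ i∷ x) ∷ []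
lower p (i∷ x)               = []

patDown : ∀ {a b} → Pat a b → Comb (Pat a b)
patDown []     = []
patDown (o∷ x) = raise x ++ cmap o∷_ (patDown x)
patDown (i∷ x) = cmap i∷_ (patDown x)

-- p letters precede the pattern; letters j and j + 1 of a word of length n are exchanged with coefficient
-- j (n − j).
patUp : ∀ {a b} → ℕ → Pat a b → Comb (Pat a b)
patUp p []     = []
patUp p (o∷ x) = cmap o∷_ (patUp (suc p) x)
patUp p (i∷ x) = lower p x ++ cmap i∷_ (patUp (suc p) x)

eval-[] : ∀ {B : Set} (l : Comb B) → eval l (λ _ → + 0) ≡ + 0
eval-[] l = eval-zero (All.universal (λ _ → refl) l)

eval-single : ∀ {B : Set} c x (φ : B → ℤ) → eval ((c , x) ∷ []) φ ≡ c * φ x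
eval-single c x φ = ℤ.+-identityʳ (c * φ x)

module _ {a b : ℕ} where

  eval-down-o : ∀ (x : Pat a b) φ → eval (patDown (o∷ x)) φ ≡ eval (raise x) φ + eval (patDown x) (φ ∘ o∷_)
  eval-down-o x φ = trans (eval-++ (raise x) _ φ) (cong (λ z → eval (raise x) φ + z) (eval-cmap o∷_ (patDown x) φ))

  eval-down-i : ∀ (x : Pat a b) φ → eval (patDown (i∷ x)) φ ≡ eval (patDown x) (φ ∘ i∷_)
  eval-down-i x φ = eval-cmap i∷_ (patDown x) φ

  eval-up-o : ∀ p (x : Pat a b) φ → eval (patUp p (o∷ x)) φ ≡ eval (patUp (suc p) x) (φ ∘ o∷_)
  eval-up-o p x φ = eval-cmap o∷_ (patUp (suc p) x) φ

  eval-up-i : ∀ p (x : Pat a b) φ → eval (patUp p (i∷ x)) φ ≡ eval (lower p x) φ + eval (patUp (suc p) x) (φ ∘ i∷_)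
  eval-up-i p x φ = trans (eval-++ (lower p x) _ φ) (cong (λ z → eval (lower p x) φ + z) (eval-cmap i∷_ (patUp (suc p) x) φ))

-- The diagonal contribution of the front exchange to the commutator: its coefficient when the
-- implicit leading letter, `o` for `ascent` and `i` for `descent`, is exchanged with the head of
-- `x` and back.
ascent descent : ∀ {a b} → ℕ → Pat a b → ℤ
ascent p []               = + 0
ascent p (o∷ x)           = + 0
ascent p (i∷_ {a} {b} x)  = + suc p * + suc (a ℕ.+ b)
descent p []              = + 0
descent p (o∷_ {a} {b} x) = + suc p * + suc (a ℕ.+ b)
descent p (i∷ x)          = + 0

-- Moves at disjoint places commute, and moves at overlapping places never follow each other: after
-- one of them the letters needed for the other are equal. What remains is the front exchange undone
-- at once.
raise-up : ∀ {a b} p (x : Pat a b) φ →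
           eval (raise x) (λ y → eval (patUp p y) φ)
         ≡ eval (patUp (suc p) x) (λ y → eval (raise y) φ) + ascent p x * φ (o∷ x)
raise-up p []     φ = refl
raise-up p (o∷ x) φ = sym (trans (cong (_+ + 0) (trans (eval-up-o (suc p) x _) (eval-[] (patUp (suc (suc p)) x)))) refl)
raise-up p (i∷_ {a} {b} x) φ = begin
  eval (raise (i∷ x)) (λ y → eval (patUp p y) φ)
    ≡⟨ trans (eval-single (+ 1) (i∷ o∷ x) (λ y → eval (patUp p y) φ)) (ℤ.*-identityˡ _) ⟩
  eval (patUp p (i∷ o∷ x)) φ
    ≡⟨ trans (eval-up-i p (o∷ x) φ) (cong₂ _+_ (eval-single c (o∷ i∷ x) φ) (eval-up-o (suc p) x _)) ⟩
  c * φ (o∷ i∷ x) + eval (patUp (suc (suc p)) x) (λ y → φ (i∷ o∷ y))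
    ≡⟨ ℤ.+-comm (c * φ (o∷ i∷ x)) _ ⟩
  eval (patUp (suc (suc p)) x) (λ y → φ (i∷ o∷ y)) + c * φ (o∷ i∷ x)
    ≡⟨ cong (_+ c * φ (o∷ i∷ x)) (sym up-raise) ⟩
  eval (patUp (suc p) (i∷ x)) (λ y → eval (raise y) φ) + c * φ (o∷ i∷ x) ∎
  where
  open ≡-Reasoning
  c = + suc p * + suc (a ℕ.+ b)
  lower-raise : ∀ {a b} (x : Pat a b) φ → eval (lower (suc p) x) (λ y → eval (raise y) φ) ≡ + 0
  lower-raise []     φ = refl
  lower-raise (o∷_ {a} {b} x) φ = trans (ℤ.+-identityʳ _) (ℤ.*-zeroʳ (+ suc (suc p) * + suc (a ℕ.+ b)))
  lower-raise (i∷ x) φ = refl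
  up-raise : eval (patUp (suc p) (i∷ x)) (λ y → eval (raise y) φ)
           ≡ eval (patUp (suc (suc p)) x) (λ y → φ (i∷ o∷ y))
  up-raise = trans (eval-up-i (suc p) x _) (trans
    (cong₂ _+_ (lower-raise x φ)
      (eval-ext (λ y → trans (eval-single (+ 1) (i∷ o∷ y) φ) (ℤ.*-identityˡ _)) (patUp (suc (suc p)) x)))
    (ℤ.+-identityˡ _))

-- The mirror image of `raise-up`, with the front exchange going up first.
lower-down : ∀ {a b} p (x : Pat a b) φ →
             eval (lower p x) (λ y → eval (patDown y) φ)
           ≡ eval (patDown x) (λ y → eval (lower p y) φ) + descent p x * φ (i∷ x)
lower-down p []     φ = refl
lower-down p (i∷ x) φ = sym (trans (cong (_+ + 0) (trans (eval-down-i x _) (eval-[] (patDown x)))) refl)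
lower-down p (o∷_ {a} {b} x) φ = begin
  eval (lower p (o∷ x)) (λ y → eval (patDown y) φ)
    ≡⟨ eval-single c (o∷ i∷ x) (λ y → eval (patDown y) φ) ⟩
  c * eval (patDown (o∷ i∷ x)) φ
    ≡⟨ cong (c *_) (trans (eval-down-o (i∷ x) φ) (cong₂ _+_
         (trans (eval-single (+ 1) (i∷ o∷ x) φ) (ℤ.*-identityˡ _)) (eval-down-i x _))) ⟩
  c * (φ (i∷ o∷ x) + eval (patDown x) (λ y → φ (o∷ i∷ y)))
    ≡⟨ regroup c (φ (i∷ o∷ x)) (eval (patDown x) (λ y → φ (o∷ i∷ y))) ⟩
  c * eval (patDown x) (λ y → φ (o∷ i∷ y)) + c * φ (i∷ o∷ x)
    ≡⟨ cong (_+ c * φ (i∷ o∷ x)) (sym down-lower) ⟩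
  eval (patDown (o∷ x)) (λ y → eval (lower p y) φ) + c * φ (i∷ o∷ x) ∎
  where
  open ≡-Reasoning
  c = + suc p * + suc (a ℕ.+ b)
  regroup : ∀ c x y → c * (x + y) ≡ c * y + c * x
  regroup = solve-∀
  raise-lower : ∀ {a b} (x : Pat a b) φ → eval (raise x) (λ y → eval (lower p y) φ) ≡ + 0
  raise-lower []     φ = refl
  raise-lower (o∷ x) φ = refl
  raise-lower (i∷ x) φ = refl
  down-lower : eval (patDown (o∷ x)) (λ y → eval (lower p y) φ) ≡ c * eval (patDown x) (λ y → φ (o∷ i∷ y))
  down-lower = trans (eval-down-o x _) (trans
    (cong₂ _+_ (raise-lower x φ) (trans
      (eval-ext (λ y → eval-single c (o∷ i∷ y) φ) (patDown x)) (eval-* (patDown x) c _)))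
    (ℤ.+-identityˡ _))

head : ∀ {a b} → Pat a b → ℤ
head []     = + 0
head (o∷ _) = + 0
head (i∷ _) = + 1

-- With c_j = j (n - j) and x_j = 1 for the letter `i`, the commutator is diagonal with entry the
-- sum of c_j (x_{j+1} - x_j) over the adjacent pairs behind the first `p` letters. Abel summation
-- gives the first two terms, since c_{j-1} - c_j = 2j - n - 1. The last is the boundary term c_p at
-- the head, with n = p + a + b; it disappears for `p` = 0.
patWeight : ∀ {a b} → ℕ → Pat a b → ℤ
patWeight {a} {b} p x = + 2 * + patRank x + + b * (+ p - + a) - head x * (+ p * (+ a + + b))

patWeight-o : ∀ {a b} p (x : Pat a b) → patWeight p (o∷ x) ≡ patWeight (suc p) x + ascent p x
patWeight-o p [] = lemma (+ p)
  where
  lemma : ∀ p → + 2 * + 0 + + 0 * (p - + 1) - + 0 * (p * (+ 1 + + 0))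
              ≡ (+ 2 * + 0 + + 0 * ((+ 1 + p) - + 0) - + 0 * ((+ 1 + p) * (+ 0 + + 0))) + + 0
  lemma = solve-∀
patWeight-o p (o∷_ {a} {b} x) = lemma (+ p) (+ a) (+ b) (+ patRank x)
  where
  lemma : ∀ p a b r → + 2 * (b + (b + r)) + b * (p - (+ 2 + a)) - + 0 * (p * ((+ 2 + a) + b))
                    ≡ (+ 2 * (b + r) + b * ((+ 1 + p) - (+ 1 + a)) - + 0 * ((+ 1 + p) * ((+ 1 + a) + b))) + + 0
  lemma = solve-∀
patWeight-o p (i∷_ {a} {b} x) = lemma (+ p) (+ a) (+ b) (+ patRank x)
  where
  lemma : ∀ p a b r → + 2 * ((+ 1 + b) + r) + (+ 1 + b) * (p - (+ 1 + a)) - + 0 * (p * ((+ 1 + a) + (+ 1 + b)))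
                    ≡ (+ 2 * r + (+ 1 + b) * ((+ 1 + p) - a) - + 1 * ((+ 1 + p) * (a + (+ 1 + b))))
                      + (+ 1 + p) * (+ 1 + (a + b))
  lemma = solve-∀

patWeight-i : ∀ {a b} p (x : Pat a b) → patWeight p (i∷ x) ≡ patWeight (suc p) x - descent p x
patWeight-i p [] = lemma (+ p)
  where
  lemma : ∀ p → + 2 * + 0 + + 1 * (p - + 0) - + 1 * (p * (+ 0 + + 1))
              ≡ (+ 2 * + 0 + + 0 * ((+ 1 + p) - + 0) - + 0 * ((+ 1 + p) * (+ 0 + + 0))) - + 0
  lemma = solve-∀
patWeight-i p (o∷_ {a} {b} x) = lemma (+ p) (+ a) (+ b) (+ patRank x)
  where
  lemma : ∀ p a b r → + 2 * (b + r) + (+ 1 + b) * (p - (+ 1 + a)) - + 1 * (p * ((+ 1 + a) + (+ 1 + b)))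
                    ≡ (+ 2 * (b + r) + b * ((+ 1 + p) - (+ 1 + a)) - + 0 * ((+ 1 + p) * ((+ 1 + a) + b)))
                      - (+ 1 + p) * (+ 1 + (a + b))
  lemma = solve-∀
patWeight-i p (i∷_ {a} {b} x) = lemma (+ p) (+ a) (+ b) (+ patRank x)
  where
  lemma : ∀ p a b r → + 2 * r + (+ 2 + b) * (p - a) - + 1 * (p * (a + (+ 2 + b)))
                    ≡ (+ 2 * r + (+ 1 + b) * ((+ 1 + p) - a) - + 1 * ((+ 1 + p) * (a + (+ 1 + b)))) - + 0
  lemma = solve-∀

-- The induction strips front letters while the coefficients of F remember the position, hence the
-- general `p`. Each letter adds one diagonal term, matched by `patWeight-o` or `patWeight-i`.
patCommutator : ∀ {a b} p φ (x : Pat a b) →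
                eval (patDown x) (λ y → eval (patUp p y) φ)
              ≡ eval (patUp p x) (λ y → eval (patDown y) φ) + patWeight p x * φ x
patCommutator p φ [] = lemma (+ p) (φ [])
  where
  lemma : ∀ p z → + 0 ≡ + 0 + (+ 2 * + 0 + + 0 * (p - + 0) - + 0 * (p * (+ 0 + + 0))) * z
  lemma = solve-∀
patCommutator p φ (o∷ x) = begin
  eval (patDown (o∷ x)) (λ y → eval (patUp p y) φ)
    ≡⟨ eval-down-o x _ ⟩
  eval (raise x) (λ y → eval (patUp p y) φ) + eval (patDown x) (λ y → eval (patUp p (o∷ y)) φ)
    ≡⟨ cong₂ _+_ (raise-up p x φ) (trans (eval-ext (λ y → eval-up-o p y φ) (patDown x))
         (patCommutator (suc p) (φ ∘ o∷_) x)) ⟩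
  (U + ascent p x * φ (o∷ x)) + (D + patWeight (suc p) x * φ (o∷ x))
    ≡⟨ regroup U D (ascent p x) (patWeight (suc p) x) (φ (o∷ x)) ⟩
  (U + D) + (patWeight (suc p) x + ascent p x) * φ (o∷ x)
    ≡⟨ cong₂ (λ u w → u + w * φ (o∷ x))
         (sym (trans (eval-up-o p x _) (trans (eval-ext (λ y → eval-down-o y φ) (patUp (suc p) x))
            (eval-+ (patUp (suc p) x) _ _))))
         (sym (patWeight-o p x)) ⟩
  eval (patUp p (o∷ x)) (λ y → eval (patDown y) φ) + patWeight p (o∷ x) * φ (o∷ x) ∎
  where
  open ≡-Reasoning
  U = eval (patUp (suc p) x) (λ y → eval (raise y) φ)
  D = eval (patUp (suc p) x) (λ y → eval (patDown y) (φ ∘ o∷_))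
  regroup : ∀ u d s w z → (u + s * z) + (d + w * z) ≡ (u + d) + (w + s) * z
  regroup = solve-∀
patCommutator p φ (i∷ x) = begin
  eval (patDown (i∷ x)) (λ y → eval (patUp p y) φ)
    ≡⟨ trans (eval-down-i x _) (trans (eval-ext (λ y → eval-up-i p y φ) (patDown x)) (eval-+ (patDown x) _ _)) ⟩
  L + eval (patDown x) (λ y → eval (patUp (suc p) y) (φ ∘ i∷_))
    ≡⟨ cong (λ z → L + z) (patCommutator (suc p) (φ ∘ i∷_) x) ⟩
  L + (D + patWeight (suc p) x * φ (i∷ x))
    ≡⟨ regroup L D (descent p x) (patWeight (suc p) x) (φ (i∷ x)) ⟩
  (L + descent p x * φ (i∷ x)) + D + (patWeight (suc p) x - descent p x) * φ (i∷ x)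
    ≡⟨ cong₂ (λ u w → u + w * φ (i∷ x))
         (sym (trans (eval-up-i p x _) (cong₂ _+_ (lower-down p x φ)
            (eval-ext (λ y → eval-down-i y φ) (patUp (suc p) x)))))
         (sym (patWeight-i p x)) ⟩
  eval (patUp p (i∷ x)) (λ y → eval (patDown y) φ) + patWeight p (i∷ x) * φ (i∷ x) ∎
  where
  open ≡-Reasoning
  L = eval (patDown x) (λ y → eval (lower p y) φ)
  D = eval (patUp (suc p) x) (λ y → eval (patDown y) (φ ∘ i∷_))
  regroup : ∀ l d s w z → l + (d + w * z) ≡ (l + s * z) + d + (w - s) * z
  regroup = solve-∀

over-cmap : ∀ {p q} {B B′ : Set} {P : B → Set p} {Q : B′ → Set q} {f : B → B′} {l} →
            (∀ {y} → P y → Q (f y)) → Over P l → Over Q (cmap f l)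
over-cmap f⁺ ps = All.map⁺ (All.map f⁺ ps)

patDown-rank : ∀ {a b} (x : Pat a b) → Over (λ y → suc (patRank y) ≡ patRank x) (patDown x)
patDown-rank []                   = []
patDown-rank (i∷ x)               = over-cmap id (patDown-rank x)
patDown-rank (o∷_ {b = b} x) = All.++⁺ (raised x)
  (over-cmap (λ ry → trans (sym (ℕ.+-suc b _)) (cong (b ℕ.+_) ry)) (patDown-rank x))
  where
  raised : ∀ {a b} (x : Pat a b) → Over (λ y → suc (patRank y) ≡ b ℕ.+ patRank x) (raise x)
  raised []     = []
  raised (o∷ x) = []
  raised (i∷ x) = refl ∷ []

patUp-rank : ∀ {a b} p (x : Pat a b) → Over (λ y → patRank y ≡ suc (patRank x)) (patUp p x)
patUp-rank p []               = []
patUp-rank p (o∷_ {b = b} x) = over-cmap (λ ry → trans (cong (b ℕ.+_) ry) (ℕ.+-suc b _)) (patUp-rank (suc p) x)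
patUp-rank p (i∷ x)           = All.++⁺ (lowered x) (over-cmap id (patUp-rank (suc p) x))
  where
  lowered : ∀ {a b} (x : Pat a b) → Over (λ y → patRank y ≡ suc (patRank x)) (lower p x)
  lowered []     = []
  lowered (o∷ x) = refl ∷ []
  lowered (i∷ x) = []

patRank-≤ : ∀ {a b} (x : Pat a b) → patRank x ℕ.≤ a ℕ.* b
patRank-≤ []                       = ℕ.z≤n
patRank-≤ (o∷_ {b = b} x)      = ℕ.+-monoʳ-≤ b (patRank-≤ x)
patRank-≤ (i∷_ {a = a} {b} x) = ℕ.≤-trans (patRank-≤ x) (ℕ.*-monoʳ-≤ a (ℕ.n≤1+n b))

pats : ∀ a b → List (Pat a b)
pats zero    zero    = [] ∷ []
pats (suc a) zero    = map o∷_ (pats a zero)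
pats zero    (suc b) = map i∷_ (pats zero b)
pats (suc a) (suc b) = map o∷_ (pats a (suc b)) ++ map i∷_ (pats (suc a) b)

o∷-injective : ∀ {a b} {x y : Pat a b} → o∷ x ≡ o∷ y → x ≡ y
o∷-injective refl = refl

i∷-injective : ∀ {a b} {x y : Pat a b} → i∷ x ≡ i∷ y → x ≡ y
i∷-injective refl = refl

pats-unique : ∀ a b → Unique (pats a b)
pats-unique zero    zero    = [] ∷ []
pats-unique (suc a) zero    = Unique.map⁺ o∷-injective (pats-unique a zero)
pats-unique zero    (suc b) = Unique.map⁺ i∷-injective (pats-unique zero b)
pats-unique (suc a) (suc b) = Unique.++⁺
  (Unique.map⁺ o∷-injective (pats-unique a (suc b)))
  (Unique.map⁺ i∷-injective (pats-unique (suc a) b))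
  λ (x∈o , x∈i) → disjoint (∈-map⁻ o∷_ x∈o) (∈-map⁻ i∷_ x∈i)
  where
  disjoint : ∀ {x : Pat (suc a) (suc b)} {xs ys} →
             (∃ λ y → y ∈ xs × x ≡ o∷ y) → (∃ λ y → y ∈ ys × x ≡ i∷ y) → ⊥
  disjoint (_ , _ , refl) (_ , _ , ())

pats-complete : ∀ {a b} (x : Pat a b) → x ∈ pats a b
pats-complete []                         = here refl
pats-complete (o∷_ {b = zero} x)         = ∈-map⁺ o∷_ (pats-complete x)
pats-complete (o∷_ {b = suc b} x)        = ∈-++⁺ˡ (∈-map⁺ o∷_ (pats-complete x))
pats-complete (i∷_ {a = zero} x)         = ∈-map⁺ i∷_ (pats-complete x)
pats-complete (i∷_ {a = suc a} {b} x)    = ∈-++⁺ʳ (map o∷_ (pats a (suc b))) (∈-map⁺ i∷_ (pats-complete x))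

patRep : ∀ a b → Rep (Pat a b)
patRep a b = record
  { down       = patDown
  ; up         = patUp 0
  ; rank       = patRank
  ; top        = a ℕ.* b
  ; elems      = pats a b
  ; unique     = pats-unique a b
  ; complete   = pats-complete
  ; rank-≤     = patRank-≤
  ; down-rank  = patDown-rank
  ; up-rank    = patUp-rank 0
  ; commutator = λ φ x → trans (patCommutator 0 φ x)
      (cong (λ w → eval (patUp 0 x) (λ y → eval (patDown y) φ) + w * φ x)
        (trans (lemma (+ patRank x) (+ a) (+ b) (head x)) (cong (λ t → + 2 * + patRank x - t) (sym (ℤ.pos-* a b)))))
  }
  where
  lemma : ∀ r a b z → + 2 * r + b * (+ 0 - a) - z * (+ 0 * (a + b)) ≡ + 2 * r - a * b
  lemma = solve-∀

unitRep : Rep ⊤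
unitRep = record
  { down       = λ _ → []
  ; up         = λ _ → []
  ; rank       = λ _ → 0
  ; top        = 0
  ; elems      = tt ∷ []
  ; unique     = [] ∷ []
  ; complete   = λ _ → here refl
  ; rank-≤     = λ _ → ℕ.z≤n
  ; down-rank  = λ _ → []
  ; up-rank    = λ _ → []
  ; commutator = λ _ _ → refl
  }

-- Tensor products of representations

module _ {B B′ : Set} (V : Rep B) (V′ : Rep B′) where
  private
    module V = Rep V
    module V′ = Rep V′

    _⊕_ : (B → Comb B) → (B′ → Comb B′) → B × B′ → Comb (B × B′)
    (f ⊕ g) (x , y) = cmap (_, y) (f x) ++ cmap (x ,_) (g y)

    eval-⊕ : ∀ f g φ x y → eval ((f ⊕ g) (x , y)) φ ≡ eval (f x) (λ z → φ (z , y)) + eval (g y) (λ z → φ (x , z))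
    eval-⊕ f g φ x y = trans (eval-++ (cmap (_, y) (f x)) _ φ)
      (cong₂ _+_ (eval-cmap (_, y) (f x) φ) (eval-cmap (x ,_) (g y) φ))

    eval-⊕² : ∀ f g f′ g′ φ x y → eval ((f ⊕ g) (x , y)) (λ z → eval ((f′ ⊕ g′) z) φ)
      ≡ (eval (f x) (λ z → eval (f′ z) (λ u → φ (u , y))) + eval (f x) (λ z → eval (g′ y) (λ u → φ (z , u))))
      + (eval (g y) (λ z → eval (f′ x) (λ u → φ (u , z))) + eval (g y) (λ z → eval (g′ z) (λ u → φ (x , u))))
    eval-⊕² f g f′ g′ φ x y = trans (eval-⊕ f g _ x y) (cong₂ _+_
      (trans (eval-ext (λ z → eval-⊕ f′ g′ φ z y) (f x)) (eval-+ (f x) _ _))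
      (trans (eval-ext (λ z → eval-⊕ f′ g′ φ x z) (g y)) (eval-+ (g y) _ _)))

  -- The mixed terms of the commutator act on different factors and cancel by `eval-comm`; the two
  -- commutators add up, and so do the weights.
  productRep : Rep (B × B′)
  productRep = record
    { down       = V.down ⊕ V′.down
    ; up         = V.up ⊕ V′.up
    ; rank       = λ (x , y) → V.rank x ℕ.+ V′.rank y
    ; top        = V.top ℕ.+ V′.top
    ; elems      = cartesianProduct V.elems V′.elems
    ; unique     = Unique.cartesianProduct⁺ V.unique V′.unique
    ; complete   = λ (x , y) → ∈-cartesianProduct⁺ (V.complete x) (V′.complete y)
    ; rank-≤     = λ (x , y) → ℕ.+-mono-≤ (V.rank-≤ x) (V′.rank-≤ y)
    ; down-rank  = λ (x , y) → All.++⁺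
        (over-cmap (cong (ℕ._+ V′.rank y)) (V.down-rank x))
        (over-cmap (λ r → trans (sym (ℕ.+-suc (V.rank x) _)) (cong (V.rank x ℕ.+_) r)) (V′.down-rank y))
    ; up-rank    = λ (x , y) → All.++⁺
        (over-cmap (cong (ℕ._+ V′.rank y)) (V.up-rank x))
        (over-cmap (λ r → trans (cong (V.rank x ℕ.+_) r) (ℕ.+-suc (V.rank x) _)) (V′.up-rank y))
    ; commutator = λ φ (x , y) → begin
        _ ≡⟨ eval-⊕² V.down V′.down V.up V′.up φ x y ⟩
        _ ≡⟨ cong₂ _+_
               (cong₂ _+_ (V.commutator (λ u → φ (u , y)) x) (eval-comm (V.down x) (V′.up y) (λ z u → φ (z , u))))
               (cong₂ _+_ (eval-comm (V′.down y) (V.up x) (λ z u → φ (u , z))) (V′.commutator (λ u → φ (x , u)) y)) ⟩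
        _ ≡⟨ regroup (eval (V.up x) (λ z → eval (V.down z) (λ u → φ (u , y))))
                     (eval (V.up x) (λ z → eval (V′.down y) (λ u → φ (z , u))))
                     (eval (V′.up y) (λ z → eval (V.down x) (λ u → φ (u , z))))
                     (eval (V′.up y) (λ z → eval (V′.down z) (λ u → φ (x , u))))
                     (+ V.rank x) (+ V′.rank y) (+ V.top) (+ V′.top) (φ (x , y)) ⟩
        _ ≡⟨ cong (_+ (+ 2 * + (V.rank x ℕ.+ V′.rank y) - + (V.top ℕ.+ V′.top)) * φ (x , y))
               (sym (eval-⊕² V.up V′.up V.down V′.down φ x y)) ⟩
        _ ∎
    }
    where
    open ≡-Reasoning
    regroup : ∀ a b c d r r′ t t′ z →
      ((a + (+ 2 * r - t) * z) + c) + (b + (d + (+ 2 * r′ - t′) * z))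
      ≡ ((a + b) + (c + d)) + (+ 2 * (r + r′) - (t + t′)) * z
    regroup = solve-∀

-- Here `α` lists the multiplicities of the letters in increasing order. The pattern marks by `o`
-- the places of the smallest letter; the rest is the subword of the larger letters.
Word : List ℕ → Set
Word []      = ⊤
Word (a ∷ α) = Pat a (sum α) × Word α

wordRep : ∀ α → Rep (Word α)
wordRep []      = unitRep
wordRep (a ∷ α) = productRep (patRep a (sum α)) (wordRep α)

-- Polynomials and the q-multinomial

infix 4 _≋_

-- _≈ₚ_ as a record, so that the polynomials can be inferred from an equation.
record _≋_ (p q : Poly) : Set where
  constructor coeffs
  field at : p ≈ₚ q
open _≋_

≋-setoid : Setoid _ _
≋-setoid = record
  { Carrier = Poly ; _≈_ = _≋_
  ; isEquivalence = record
    { refl  = coeffs λ _ → refl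
    ; sym   = λ e → coeffs λ k → sym (at e k)
    ; trans = λ e e′ → coeffs λ k → trans (at e k) (at e′ k)
    }
  }

open Setoid ≋-setoid using () renaming (refl to ≋-refl; sym to ≋-sym; trans to ≋-trans; reflexive to ≋-reflexive)

scaleₚ : ℤ → Poly → Poly
scaleₚ a = map (a *_)

shift : Poly → Poly
shift p = + 0 ∷ p

coeff-+ : ∀ p q k → coeff (p +ₚ q) k ≡ coeff p k + coeff q k
coeff-+ []      q       k       = sym (ℤ.+-identityˡ _)
coeff-+ (a ∷ p) []      k       = sym (ℤ.+-identityʳ _)
coeff-+ (a ∷ p) (b ∷ q) zero    = refl
coeff-+ (a ∷ p) (b ∷ q) (suc k) = coeff-+ p q k

coeff-scale : ∀ a p k → coeff (scaleₚ a p) k ≡ a * coeff p k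
coeff-scale a []      k       = sym (ℤ.*-zeroʳ a)
coeff-scale a (b ∷ p) zero    = refl
coeff-scale a (b ∷ p) (suc k) = coeff-scale a p k

+ₚ-cong : ∀ {p p′ q q′} → p ≋ p′ → q ≋ q′ → p +ₚ q ≋ p′ +ₚ q′
+ₚ-cong {p} {p′} {q} {q′} e e′ = coeffs λ k →
  trans (coeff-+ p q k) (trans (cong₂ _+_ (at e k) (at e′ k)) (sym (coeff-+ p′ q′ k)))

+ₚ-comm : ∀ p q → p +ₚ q ≋ q +ₚ p
+ₚ-comm p q = coeffs λ k → trans (coeff-+ p q k) (trans (ℤ.+-comm (coeff p k) _) (sym (coeff-+ q p k)))

+ₚ-assoc : ∀ p q r → (p +ₚ q) +ₚ r ≋ p +ₚ (q +ₚ r)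
+ₚ-assoc p q r = coeffs λ k → begin
  coeff ((p +ₚ q) +ₚ r) k                 ≡⟨ trans (coeff-+ (p +ₚ q) r k) (cong (_+ coeff r k) (coeff-+ p q k)) ⟩
  coeff p k + coeff q k + coeff r k       ≡⟨ ℤ.+-assoc (coeff p k) _ _ ⟩
  coeff p k + (coeff q k + coeff r k)     ≡⟨ trans (coeff-+ p (q +ₚ r) k) (cong (λ z → coeff p k + z) (coeff-+ q r k)) ⟨
  coeff (p +ₚ (q +ₚ r)) k                 ∎
  where open ≡-Reasoning

+ₚ-isCommutativeMonoid : IsCommutativeMonoid _≋_ _+ₚ_ []
+ₚ-isCommutativeMonoid = record
  { isMonoid = record
    { isSemigroup = record
      { isMagma = record { isEquivalence = Setoid.isEquivalence ≋-setoid ; ∙-cong = +ₚ-cong }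
      ; assoc   = +ₚ-assoc
      }
    ; identity = (λ _ → ≋-refl) , (λ p → +ₚ-comm p [])
    }
  ; comm = +ₚ-comm
  }

+ₚ-commutativeMonoid : CommutativeMonoid _ _
+ₚ-commutativeMonoid = record { isCommutativeMonoid = +ₚ-isCommutativeMonoid }

module +ₚ where
  open CommutativeMonoid +ₚ-commutativeMonoid public
  open CommutativeSemigroupProperties commutativeSemigroup public

scale-cong : ∀ a {p q} → p ≋ q → scaleₚ a p ≋ scaleₚ a q
scale-cong a {p} {q} e = coeffs λ k →
  trans (coeff-scale a p k) (trans (cong (a *_) (at e k)) (sym (coeff-scale a q k)))

scale-+ : ∀ a p q → scaleₚ a (p +ₚ q) ≋ scaleₚ a p +ₚ scaleₚ a q
scale-+ a p q = coeffs λ k → begin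
  coeff (scaleₚ a (p +ₚ q)) k              ≡⟨ trans (coeff-scale a (p +ₚ q) k) (cong (a *_) (coeff-+ p q k)) ⟩
  a * (coeff p k + coeff q k)              ≡⟨ ℤ.*-distribˡ-+ a _ _ ⟩
  a * coeff p k + a * coeff q k            ≡⟨ trans (coeff-+ (scaleₚ a p) (scaleₚ a q) k)
                                                (cong₂ _+_ (coeff-scale a p k) (coeff-scale a q k)) ⟨
  coeff (scaleₚ a p +ₚ scaleₚ a q) k       ∎
  where open ≡-Reasoning

scale-+ˡ : ∀ a b p → scaleₚ (a + b) p ≋ scaleₚ a p +ₚ scaleₚ b p
scale-+ˡ a b p = coeffs λ k → begin
  coeff (scaleₚ (a + b) p) k               ≡⟨ coeff-scale (a + b) p k ⟩
  (a + b) * coeff p k                      ≡⟨ ℤ.*-distribʳ-+ (coeff p k) a b ⟩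
  a * coeff p k + b * coeff p k            ≡⟨ trans (coeff-+ (scaleₚ a p) (scaleₚ b p) k)
                                                (cong₂ _+_ (coeff-scale a p k) (coeff-scale b p k)) ⟨
  coeff (scaleₚ a p +ₚ scaleₚ b p) k       ∎
  where open ≡-Reasoning

scale-* : ∀ a b p → scaleₚ (a * b) p ≋ scaleₚ a (scaleₚ b p)
scale-* a b p = coeffs λ k → begin
  coeff (scaleₚ (a * b) p) k           ≡⟨ trans (coeff-scale (a * b) p k) (ℤ.*-assoc a b _) ⟩
  a * (b * coeff p k)                  ≡⟨ trans (coeff-scale a (scaleₚ b p) k) (cong (a *_) (coeff-scale b p k)) ⟨
  coeff (scaleₚ a (scaleₚ b p)) k      ∎
  where open ≡-Reasoning

scale-0 : ∀ p → scaleₚ (+ 0) p ≋ []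
scale-0 p = coeffs λ k → coeff-scale (+ 0) p k

scale-1 : ∀ p → scaleₚ (+ 1) p ≋ p
scale-1 p = coeffs λ k → trans (coeff-scale (+ 1) p k) (ℤ.*-identityˡ _)

shift-cong : ∀ {p q} → p ≋ q → shift p ≋ shift q
shift-cong e = coeffs λ { zero → refl ; (suc k) → at e k }

shift-[] : shift [] ≋ []
shift-[] = coeffs λ { zero → refl ; (suc k) → refl }

*ₚ-congʳ : ∀ p {q r} → q ≋ r → p *ₚ q ≋ p *ₚ r
*ₚ-congʳ []      e = ≋-refl
*ₚ-congʳ (a ∷ p) e = +ₚ-cong (scale-cong a e) (shift-cong (*ₚ-congʳ p e))

*ₚ-[] : ∀ p → p *ₚ [] ≋ []
*ₚ-[] []      = ≋-refl
*ₚ-[] (a ∷ p) = ≋-trans (shift-cong (*ₚ-[] p)) shift-[]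

*ₚ-∷ : ∀ p b q → p *ₚ (b ∷ q) ≋ scaleₚ b p +ₚ shift (p *ₚ q)
*ₚ-∷ []      b q = ≋-sym shift-[]
*ₚ-∷ (a ∷ p) b q = coeffs λ { zero → cong (_+ + 0) (ℤ.*-comm a b) ; (suc k) → at tail k }
  where
  open SetoidReasoning ≋-setoid
  tail : scaleₚ a q +ₚ (p *ₚ (b ∷ q)) ≋ scaleₚ b p +ₚ ((a ∷ p) *ₚ q)
  tail = begin
    scaleₚ a q +ₚ (p *ₚ (b ∷ q))                    ≈⟨ +ₚ.∙-congˡ (*ₚ-∷ p b q) ⟩
    scaleₚ a q +ₚ (scaleₚ b p +ₚ shift (p *ₚ q))    ≈⟨ +ₚ.x∙yz≈y∙xz (scaleₚ a q) (scaleₚ b p) _ ⟩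
    scaleₚ b p +ₚ (scaleₚ a q +ₚ shift (p *ₚ q))    ∎

*ₚ-comm : ∀ p q → p *ₚ q ≋ q *ₚ p
*ₚ-comm []      q = ≋-sym (*ₚ-[] q)
*ₚ-comm (a ∷ p) q = ≋-trans (+ₚ.∙-congˡ {scaleₚ a q} (shift-cong (*ₚ-comm p q))) (≋-sym (*ₚ-∷ q a p))

*ₚ-cong : ∀ {p p′ q q′} → p ≋ p′ → q ≋ q′ → p *ₚ q ≋ p′ *ₚ q′
*ₚ-cong {p} {p′} {q} {q′} e e′ = ≋-trans (*ₚ-congʳ p e′)
  (≋-trans (*ₚ-comm p q′) (≋-trans (*ₚ-congʳ q′ e) (*ₚ-comm q′ p′)))

*ₚ-distribʳ-+ₚ : ∀ p q r → (p +ₚ q) *ₚ r ≋ (p *ₚ r) +ₚ (q *ₚ r)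
*ₚ-distribʳ-+ₚ []      q       r = ≋-refl
*ₚ-distribʳ-+ₚ (a ∷ p) []      r = +ₚ-comm [] _
*ₚ-distribʳ-+ₚ (a ∷ p) (b ∷ q) r = ≋-trans
  (+ₚ-cong (scale-+ˡ a b r) (shift-cong (*ₚ-distribʳ-+ₚ p q r)))
  (+ₚ.interchange (scaleₚ a r) (scaleₚ b r) (shift (p *ₚ r)) (shift (q *ₚ r)))

*ₚ-distribˡ-+ₚ : ∀ r p q → r *ₚ (p +ₚ q) ≋ (r *ₚ p) +ₚ (r *ₚ q)
*ₚ-distribˡ-+ₚ r p q = ≋-trans (*ₚ-comm r (p +ₚ q))
  (≋-trans (*ₚ-distribʳ-+ₚ p q r) (+ₚ-cong (*ₚ-comm p r) (*ₚ-comm q r)))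

scale-*ₚ : ∀ a p q → scaleₚ a p *ₚ q ≋ scaleₚ a (p *ₚ q)
scale-*ₚ a []      q = ≋-refl
scale-*ₚ a (b ∷ p) q = ≋-trans
  (+ₚ-cong (scale-* a b q) (≋-trans (shift-cong (scale-*ₚ a p q)) (≋-sym shift-scale)))
  (≋-sym (scale-+ a (scaleₚ b q) (shift (p *ₚ q))))
  where
  shift-scale : scaleₚ a (shift (p *ₚ q)) ≋ shift (scaleₚ a (p *ₚ q))
  shift-scale = coeffs λ { zero → ℤ.*-zeroʳ a ; (suc k) → refl }

shift-*ₚ : ∀ p q → shift p *ₚ q ≋ shift (p *ₚ q)
shift-*ₚ p q = +ₚ.∙-congʳ (scale-0 q)

*ₚ-assoc : ∀ p q r → (p *ₚ q) *ₚ r ≋ p *ₚ (q *ₚ r)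
*ₚ-assoc []      q r = ≋-refl
*ₚ-assoc (a ∷ p) q r = ≋-trans (*ₚ-distribʳ-+ₚ (scaleₚ a q) (shift (p *ₚ q)) r)
  (+ₚ-cong (scale-*ₚ a q r) (≋-trans (shift-*ₚ (p *ₚ q) r) (shift-cong (*ₚ-assoc p q r))))

*ₚ-identityˡ : ∀ p → oneₚ *ₚ p ≋ p
*ₚ-identityˡ p = ≋-trans (+ₚ-cong (scale-1 p) shift-[]) (+ₚ-comm p [])

*ₚ-commutativeMonoid : CommutativeMonoid _ _
*ₚ-commutativeMonoid = record
  { Carrier = Poly ; _≈_ = _≋_ ; _∙_ = _*ₚ_ ; ε = oneₚ
  ; isCommutativeMonoid = record
    { isMonoid = record
      { isSemigroup = record
        { isMagma = record { isEquivalence = Setoid.isEquivalence ≋-setoid ; ∙-cong = *ₚ-cong }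
        ; assoc   = *ₚ-assoc
        }
      ; identity = *ₚ-identityˡ , (λ p → ≋-trans (*ₚ-comm p oneₚ) (*ₚ-identityˡ p))
      }
    ; comm = *ₚ-comm
    }
  }

module *ₚ where
  open CommutativeMonoid *ₚ-commutativeMonoid public
  open CommutativeSemigroupProperties commutativeSemigroup public

coeff-*ₚ-cong : ∀ q p p′ k → (∀ j → j ℕ.≤ k → coeff p j ≡ coeff p′ j) → coeff (q *ₚ p) k ≡ coeff (q *ₚ p′) k
coeff-*ₚ-cong []      p p′ k e = refl
coeff-*ₚ-cong (a ∷ q) p p′ k e = begin
  coeff (scaleₚ a p +ₚ shift (q *ₚ p)) k            ≡⟨ coeff-+ (scaleₚ a p) _ k ⟩
  coeff (scaleₚ a p) k + coeff (shift (q *ₚ p)) k   ≡⟨ cong₂ _+_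
    (trans (coeff-scale a p k) (trans (cong (a *_) (e k ℕ.≤-refl)) (sym (coeff-scale a p′ k)))) (tail k e) ⟩
  coeff (scaleₚ a p′) k + coeff (shift (q *ₚ p′)) k ≡⟨ coeff-+ (scaleₚ a p′) _ k ⟨
  coeff (scaleₚ a p′ +ₚ shift (q *ₚ p′)) k          ∎
  where
  open ≡-Reasoning
  tail : ∀ k → (∀ j → j ℕ.≤ k → coeff p j ≡ coeff p′ j) → coeff (shift (q *ₚ p)) k ≡ coeff (shift (q *ₚ p′)) k
  tail zero    e = refl
  tail (suc k) e = coeff-*ₚ-cong q p p′ k λ j j≤k → e j (ℕ.m≤n⇒m≤1+n j≤k)

-- A factor with constant term 1 can be divided out coefficient by coefficient: coefficient k of the
-- product is that of `p` plus a part that depends on smaller indices only.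
*ₚ-cancelʳ : ∀ q p p′ → coeff q 0 ≡ + 1 → p *ₚ q ≋ p′ *ₚ q → p ≋ p′
*ₚ-cancelʳ (c ∷ q) p p′ refl e = coeffs λ k → upTo k k ℕ.≤-refl
  where
  open ≡-Reasoning
  expand : ∀ p k → coeff (p *ₚ (+ 1 ∷ q)) k ≡ coeff p k + coeff (shift (q *ₚ p)) k
  expand p k = begin
    coeff (p *ₚ (+ 1 ∷ q)) k                        ≡⟨ at (*ₚ-comm p (+ 1 ∷ q)) k ⟩
    coeff (scaleₚ (+ 1) p +ₚ shift (q *ₚ p)) k      ≡⟨ coeff-+ (scaleₚ (+ 1) p) _ k ⟩
    coeff (scaleₚ (+ 1) p) k + coeff (shift (q *ₚ p)) k ≡⟨ cong (_+ coeff (shift (q *ₚ p)) k) (at (scale-1 p) k) ⟩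
    coeff p k + coeff (shift (q *ₚ p)) k            ∎
  step : ∀ k → coeff (shift (q *ₚ p)) k ≡ coeff (shift (q *ₚ p′)) k → coeff p k ≡ coeff p′ k
  step k t = +-cancelʳ (coeff (shift (q *ₚ p)) k) _ _ (begin
    coeff p k + coeff (shift (q *ₚ p)) k   ≡⟨ expand p k ⟨
    coeff (p *ₚ (+ 1 ∷ q)) k               ≡⟨ at e k ⟩
    coeff (p′ *ₚ (+ 1 ∷ q)) k              ≡⟨ expand p′ k ⟩
    coeff p′ k + coeff (shift (q *ₚ p′)) k ≡⟨ cong (λ z → coeff p′ k + z) t ⟨
    coeff p′ k + coeff (shift (q *ₚ p)) k  ∎)
  upTo : ∀ k j → j ℕ.≤ k → coeff p j ≡ coeff p′ j
  upTo zero    zero ℕ.z≤n = step 0 refl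
  upTo (suc k) j    j≤    with ℕ.m≤n⇒m<n∨m≡n j≤
  ... | inj₁ (ℕ.s≤s j≤k) = upTo k j j≤k
  ... | inj₂ refl        = step (suc k) (coeff-*ₚ-cong q p p′ k (upTo k))

-- Rank generating functions

shiftBy : ℕ → Poly → Poly
shiftBy zero    p = p
shiftBy (suc r) p = shift (shiftBy r p)

shiftBy-cong : ∀ r {p q} → p ≋ q → shiftBy r p ≋ shiftBy r q
shiftBy-cong zero    e = e
shiftBy-cong (suc r) e = shift-cong (shiftBy-cong r e)

shiftBy-[] : ∀ r → shiftBy r [] ≋ []
shiftBy-[] zero    = ≋-refl
shiftBy-[] (suc r) = ≋-trans (shift-cong (shiftBy-[] r)) shift-[]

shiftBy-+ₚ : ∀ r p q → shiftBy r (p +ₚ q) ≡ shiftBy r p +ₚ shiftBy r q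
shiftBy-+ₚ zero    p q = refl
shiftBy-+ₚ (suc r) p q = cong shift (shiftBy-+ₚ r p q)

shiftBy-shiftBy : ∀ r s p → shiftBy (r ℕ.+ s) p ≡ shiftBy r (shiftBy s p)
shiftBy-shiftBy zero    s p = refl
shiftBy-shiftBy (suc r) s p = cong shift (shiftBy-shiftBy r s p)

shiftBy-*ₚ : ∀ r p q → shiftBy r p *ₚ q ≋ shiftBy r (p *ₚ q)
shiftBy-*ₚ zero    p q = ≋-refl
shiftBy-*ₚ (suc r) p q = ≋-trans (shift-*ₚ (shiftBy r p) q) (shift-cong (shiftBy-*ₚ r p q))

qInt-+ : ∀ m n → qInt (m ℕ.+ n) ≡ qInt m +ₚ shiftBy m (qInt n)
qInt-+ zero    n = refl
qInt-+ (suc m) n = cong (+ 1 ∷_) (qInt-+ m n)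

genFun : ∀ {B : Set} → (B → ℕ) → List B → Poly
genFun rank = foldr (λ x p → shiftBy (rank x) oneₚ +ₚ p) []

module _ {B : Set} (rank : B → ℕ) where

  coeff-genFun : ∀ xs k → coeff (genFun rank xs) k ≡ + length (filter (λ x → rank x ℕ.≟ k) xs)
  coeff-genFun []       k = refl
  coeff-genFun (x ∷ xs) k = trans (coeff-+ (shiftBy (rank x) oneₚ) _ k) (trans
    (cong (λ z → coeff (shiftBy (rank x) oneₚ) k + z) (coeff-genFun xs k)) (count (rank x ℕ.≟ k)))
    where
    diagonal : ∀ r → coeff (shiftBy r oneₚ) r ≡ + 1
    diagonal zero    = refl
    diagonal (suc r) = diagonal r
    off : ∀ r k → r ≢ k → coeff (shiftBy r oneₚ) k ≡ + 0
    off zero    zero    r≢k = contradiction refl r≢k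
    off zero    (suc k) r≢k = refl
    off (suc r) zero    r≢k = refl
    off (suc r) (suc k) r≢k = off r k (r≢k ∘ cong suc)
    P? : ∀ x → Dec (rank x ≡ k)
    P? x = rank x ℕ.≟ k
    count : Dec (rank x ≡ k) → coeff (shiftBy (rank x) oneₚ) k + + length (filter P? xs) ≡ + length (filter P? (x ∷ xs))
    count (yes refl) = trans (cong (_+ + length (filter P? xs)) (diagonal (rank x)))
                             (cong (λ l → + length l) (sym (filter-accept P? {x} {xs} refl)))
    count (no r≢k)   = trans (cong (_+ + length (filter P? xs)) (off (rank x) k r≢k))
                             (cong (λ l → + length l) (sym (filter-reject P? {x} {xs} r≢k)))

  genFun-++ : ∀ xs ys → genFun rank (xs ++ ys) ≋ genFun rank xs +ₚ genFun rank ys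
  genFun-++ []       ys = ≋-refl
  genFun-++ (x ∷ xs) ys = ≋-trans (+ₚ.∙-congˡ {shiftBy (rank x) oneₚ} (genFun-++ xs ys))
    (≋-sym (+ₚ-assoc (shiftBy (rank x) oneₚ) _ _))

  genFun-map : ∀ {B′ : Set} {rank′ : B′ → ℕ} {r} {f : B → B′} → (∀ x → rank′ (f x) ≡ r ℕ.+ rank x) →
               ∀ xs → genFun rank′ (map f xs) ≋ shiftBy r (genFun rank xs)
  genFun-map {r = r} eq []       = ≋-sym (shiftBy-[] r)
  genFun-map {r = r} eq (x ∷ xs) = ≋-trans
    (+ₚ-cong (≋-reflexive (trans (cong (λ s → shiftBy s oneₚ) (eq x)) (shiftBy-shiftBy r (rank x) oneₚ)))
             (genFun-map eq xs))
    (≋-reflexive (sym (shiftBy-+ₚ r _ _)))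

genFun-× : ∀ {B B′ : Set} (rank : B → ℕ) (rank′ : B′ → ℕ) xs ys →
           genFun (λ (x , y) → rank x ℕ.+ rank′ y) (cartesianProduct xs ys) ≋ genFun rank xs *ₚ genFun rank′ ys
genFun-× rank rank′ []       ys = ≋-refl
genFun-× rank rank′ (x ∷ xs) ys = begin
  genFun _ (map (x ,_) ys ++ cartesianProduct xs ys)
    ≈⟨ genFun-++ _ (map (x ,_) ys) _ ⟩
  genFun _ (map (x ,_) ys) +ₚ genFun _ (cartesianProduct xs ys)
    ≈⟨ +ₚ-cong (genFun-map rank′ (λ _ → refl) ys) (genFun-× rank rank′ xs ys) ⟩
  shiftBy (rank x) (genFun rank′ ys) +ₚ (genFun rank xs *ₚ genFun rank′ ys)
    ≈⟨ +ₚ.∙-congʳ (≋-trans (shiftBy-*ₚ (rank x) oneₚ _) (shiftBy-cong (rank x) (*ₚ-identityˡ _))) ⟨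
  (shiftBy (rank x) oneₚ *ₚ genFun rank′ ys) +ₚ (genFun rank xs *ₚ genFun rank′ ys)
    ≈⟨ *ₚ-distribʳ-+ₚ (shiftBy (rank x) oneₚ) _ _ ⟨
  genFun rank (x ∷ xs) *ₚ genFun rank′ ys ∎
  where open SetoidReasoning ≋-setoid

gauss : ℕ → ℕ → Poly
gauss a b = genFun patRank (pats a b)

-- The q-Pascal rule by the first letter: a leading `o` precedes all `b + 1` letters `i` and
-- contributes that power of q, a leading `i` contributes nothing. It matches the splitting of the
-- q-integer of a + b + 2 as that of b + 1 plus the shifted one of a + 1.
gauss-qFact : ∀ a b → gauss a b *ₚ (qFact a *ₚ qFact b) ≋ qFact (a ℕ.+ b)
gauss-qFact zero zero = coeffs λ { zero → refl ; (suc zero) → refl ; (suc (suc zero)) → refl ; (suc (suc (suc k))) → refl }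
gauss-qFact (suc a) zero = begin
  gauss (suc a) 0 *ₚ ((qFact a *ₚ qInt (suc a)) *ₚ oneₚ)
    ≈⟨ *ₚ-cong (genFun-map patRank (λ _ → refl) (pats a 0)) (*ₚ.xy∙z≈xz∙y (qFact a) (qInt (suc a)) oneₚ) ⟩
  gauss a 0 *ₚ ((qFact a *ₚ oneₚ) *ₚ qInt (suc a))
    ≈⟨ *ₚ-assoc (gauss a 0) _ _ ⟨
  (gauss a 0 *ₚ (qFact a *ₚ oneₚ)) *ₚ qInt (suc a)
    ≈⟨ *ₚ.∙-cong (gauss-qFact a 0) (≋-reflexive (cong (qInt ∘ suc) (sym (ℕ.+-identityʳ a)))) ⟩
  qFact (suc a ℕ.+ 0) ∎
  where open SetoidReasoning ≋-setoid
gauss-qFact zero (suc b) = begin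
  gauss 0 (suc b) *ₚ (oneₚ *ₚ (qFact b *ₚ qInt (suc b)))
    ≈⟨ *ₚ-cong (genFun-map patRank (λ _ → refl) (pats 0 b)) (≋-sym (*ₚ-assoc oneₚ (qFact b) (qInt (suc b)))) ⟩
  gauss 0 b *ₚ ((oneₚ *ₚ qFact b) *ₚ qInt (suc b))
    ≈⟨ *ₚ-assoc (gauss 0 b) _ _ ⟨
  (gauss 0 b *ₚ (oneₚ *ₚ qFact b)) *ₚ qInt (suc b)
    ≈⟨ *ₚ.∙-congʳ (gauss-qFact 0 b) ⟩
  qFact (suc b) ∎
  where open SetoidReasoning ≋-setoid
gauss-qFact (suc a) (suc b) = begin
  gauss (suc a) (suc b) *ₚ (A *ₚ B)
    ≈⟨ *ₚ.∙-congʳ (≋-trans (genFun-++ patRank (map o∷_ (pats a (suc b))) _)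
         (+ₚ-cong (genFun-map patRank (λ _ → refl) (pats a (suc b)))
                  (genFun-map patRank (λ _ → refl) (pats (suc a) b)))) ⟩
  (shiftBy (suc b) G₁ +ₚ G₂) *ₚ (A *ₚ B)
    ≈⟨ *ₚ-distribʳ-+ₚ (shiftBy (suc b) G₁) G₂ _ ⟩
  (shiftBy (suc b) G₁ *ₚ (A *ₚ B)) +ₚ (G₂ *ₚ (A *ₚ B))
    ≈⟨ +ₚ-cong left right ⟩
  (Q *ₚ shiftBy (suc b) (qInt (suc a))) +ₚ (Q *ₚ qInt (suc b))
    ≈⟨ *ₚ-distribˡ-+ₚ Q _ _ ⟨
  Q *ₚ (shiftBy (suc b) (qInt (suc a)) +ₚ qInt (suc b))
    ≈⟨ *ₚ-congʳ Q (≋-trans (+ₚ-comm (shiftBy (suc b) (qInt (suc a))) (qInt (suc b))) (≋-reflexive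
         (trans (sym (qInt-+ (suc b) (suc a))) (cong qInt (ℕ.+-comm (suc b) (suc a)))))) ⟩
  qFact (suc a ℕ.+ suc b) ∎
  where
  open SetoidReasoning ≋-setoid
  A = qFact (suc a)
  B = qFact (suc b)
  G₁ = gauss a (suc b)
  G₂ = gauss (suc a) b
  Q = qFact (a ℕ.+ suc b)
  left : shiftBy (suc b) G₁ *ₚ (A *ₚ B) ≋ Q *ₚ shiftBy (suc b) (qInt (suc a))
  left = begin
    shiftBy (suc b) G₁ *ₚ (A *ₚ B)
      ≈⟨ shiftBy-*ₚ (suc b) G₁ _ ⟩
    shiftBy (suc b) (G₁ *ₚ ((qFact a *ₚ qInt (suc a)) *ₚ B))
      ≈⟨ shiftBy-cong (suc b) (≋-trans (*ₚ-congʳ G₁ (*ₚ.xy∙z≈y∙xz (qFact a) (qInt (suc a)) B))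
           (*ₚ.x∙yz≈y∙xz G₁ (qInt (suc a)) (qFact a *ₚ B))) ⟩
    shiftBy (suc b) (qInt (suc a) *ₚ (G₁ *ₚ (qFact a *ₚ B)))
      ≈⟨ shiftBy-cong (suc b) (*ₚ-congʳ (qInt (suc a)) (gauss-qFact a (suc b))) ⟩
    shiftBy (suc b) (qInt (suc a) *ₚ Q)
      ≈⟨ shiftBy-*ₚ (suc b) (qInt (suc a)) Q ⟨
    shiftBy (suc b) (qInt (suc a)) *ₚ Q
      ≈⟨ *ₚ-comm (shiftBy (suc b) (qInt (suc a))) Q ⟩
    Q *ₚ shiftBy (suc b) (qInt (suc a)) ∎
  right : G₂ *ₚ (A *ₚ B) ≋ Q *ₚ qInt (suc b)
  right = begin
    G₂ *ₚ (A *ₚ (qFact b *ₚ qInt (suc b)))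
      ≈⟨ *ₚ-congʳ G₂ (≋-sym (*ₚ-assoc A (qFact b) (qInt (suc b)))) ⟩
    G₂ *ₚ ((A *ₚ qFact b) *ₚ qInt (suc b))
      ≈⟨ *ₚ-assoc G₂ _ _ ⟨
    (G₂ *ₚ (A *ₚ qFact b)) *ₚ qInt (suc b)
      ≈⟨ *ₚ.∙-congʳ (≋-trans (gauss-qFact (suc a) b) (≋-reflexive (cong qFact (sym (ℕ.+-suc a b))))) ⟩
    Q *ₚ qInt (suc b) ∎

wordGenFun : List ℕ → Poly
wordGenFun α = genFun (Rep.rank (wordRep α)) (Rep.elems (wordRep α))

wordGenFun-isQMultinomial : ∀ α → wordGenFun α *ₚ qCompFact α ≋ qFact (sum α)
wordGenFun-isQMultinomial [] = coeffs λ { zero → refl ; (suc zero) → refl ; (suc (suc k)) → refl }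
wordGenFun-isQMultinomial (a ∷ α) = begin
  wordGenFun (a ∷ α) *ₚ (qFact a *ₚ qCompFact α)
    ≈⟨ *ₚ.∙-congʳ (genFun-× patRank _ (pats a (sum α)) _) ⟩
  (gauss a (sum α) *ₚ wordGenFun α) *ₚ (qFact a *ₚ qCompFact α)
    ≈⟨ *ₚ-assoc (gauss a (sum α)) _ _ ⟩
  gauss a (sum α) *ₚ (wordGenFun α *ₚ (qFact a *ₚ qCompFact α))
    ≈⟨ *ₚ-congʳ (gauss a (sum α)) (≋-trans (*ₚ.x∙yz≈y∙xz (wordGenFun α) (qFact a) _)
         (*ₚ-congʳ (qFact a) (wordGenFun-isQMultinomial α))) ⟩
  gauss a (sum α) *ₚ (qFact a *ₚ qFact (sum α))
    ≈⟨ gauss-qFact a (sum α) ⟩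
  qFact (a ℕ.+ sum α) ∎
  where open SetoidReasoning ≋-setoid

coeff₀-*ₚ : ∀ p q → coeff (p *ₚ q) 0 ≡ coeff p 0 * coeff q 0
coeff₀-*ₚ []      q = refl
coeff₀-*ₚ (a ∷ p) q = trans (coeff-+ (scaleₚ a q) _ 0) (trans (ℤ.+-identityʳ _) (coeff-scale a q 0))

coeff₀-qFact : ∀ k → coeff (qFact k) 0 ≡ + 1
coeff₀-qFact zero    = refl
coeff₀-qFact (suc k) = trans (coeff₀-*ₚ (qFact k) _) (cong (_* + 1) (coeff₀-qFact k))

coeff₀-qCompFact : ∀ α → coeff (qCompFact α) 0 ≡ + 1
coeff₀-qCompFact []      = refl
coeff₀-qCompFact (a ∷ α) = trans (coeff₀-*ₚ (qFact a) _) (cong₂ _*_ (coeff₀-qFact a) (coeff₀-qCompFact α))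

coeff-≤-M : ∀ p → (∀ k → + 0 ≤ coeff p k) → ∀ k → coeff p k ≤ M p
coeff-≤-M []      _   k       = ℤ.≤-refl
coeff-≤-M (a ∷ p) p≥0 zero    = head≤ p
  where
  head≤ : ∀ p → a ≤ foldr ℤ._⊔_ a p
  head≤ []      = ℤ.≤-refl
  head≤ (b ∷ p) = ℤ.≤-trans (head≤ p) (ℤ.i≤j⊔i b _)
coeff-≤-M (a ∷ p) p≥0 (suc k) = tail≤ p k
  where
  tail≤ : ∀ p k → coeff p k ≤ foldr ℤ._⊔_ a p
  -- Past the end of the list the coefficient is 0, which the maximum dominates because the first
  -- coefficient is nonnegative.
  tail≤ []      k       = p≥0 0
  tail≤ (b ∷ p) zero    = ℤ.i≤i⊔j b _
  tail≤ (b ∷ p) (suc k) = ℤ.≤-trans (tail≤ p k) (ℤ.i≤j⊔i b _)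

module _ α {P} (isQMultinomial : IsQMultinomial (sum α) α P) where

  private
    P≋wordGenFun : P ≋ wordGenFun α
    P≋wordGenFun = *ₚ-cancelʳ (qCompFact α) P (wordGenFun α) (coeff₀-qCompFact α)
      (≋-trans (coeffs isQMultinomial) (≋-sym (wordGenFun-isQMultinomial α)))

    coeff-P : ∀ r → coeff P r ≡ + length (SL₂.layer (wordRep α) r)
    coeff-P r = trans (at P≋wordGenFun r) (coeff-genFun (Rep.rank (wordRep α)) (Rep.elems (wordRep α)) r)

  layer-≤-M : ∀ r → + length (SL₂.layer (wordRep α) r) ≤ M P
  layer-≤-M r = subst (_≤ M P) (coeff-P r)
    (coeff-≤-M P (λ k → subst (+ 0 ≤_) (sym (coeff-P k)) (ℤ.+≤+ ℕ.z≤n)) r)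

-- Words and arrangements of a list

private
  variable
    ℓ : Level
    A : Set ℓ

length-cartesianProductWith : ∀ {a b c} {A : Set a} {B : Set b} {C : Set c} (f : A → B → C) xs ys →
                              length (cartesianProductWith f xs ys) ≡ length xs ℕ.* length ys
length-cartesianProductWith f []       ys = refl
length-cartesianProductWith f (x ∷ xs) ys = trans (length-++ (map (f x) ys))
  (cong₂ ℕ._+_ (length-map (f x) ys) (length-cartesianProductWith f xs ys))

length-concatMap : ∀ {a b} {A : Set a} {B : Set b} (f : A → List B) {k xs} →
                   All (λ x → length (f x) ≡ k) xs → length (concatMap f xs) ≡ length xs ℕ.* k
length-concatMap f []                   = refl
length-concatMap f (_∷_ {x} {xs} e es) = trans (length-++ (f x)) (cong₂ ℕ._+_ e (length-concatMap f es))

∈-∃↭ : ∀ {x : A} {xs} → x ∈ xs → ∃ λ ys → xs ↭ x ∷ ys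
∈-∃↭ {x = x} x∈ with ∈-∃++ x∈
... | ys , zs , refl = ys ++ zs , ↭.shift x ys zs

unique-⊆-length : ∀ {xs ys : List A} → Unique xs → (∀ {x} → x ∈ xs → x ∈ ys) → length xs ℕ.≤ length ys
unique-⊆-length []             xs⊆ys = ℕ.z≤n
unique-⊆-length {xs = x ∷ xs} (x∉ ∷ uniq) xs⊆ys with ∈-∃↭ (xs⊆ys (here refl))
... | ys′ , ys↭ = subst (suc (length xs) ℕ.≤_) (sym (↭-length ys↭)) (ℕ.s≤s (unique-⊆-length uniq λ z∈ →
  strip (All.lookup x∉ z∈) (∈-resp-↭ ys↭ (xs⊆ys (there z∈)))))
  where
  strip : ∀ {z} → x ≢ z → z ∈ x ∷ ys′ → z ∈ ys′
  strip x≢z (here z≡x) = contradiction (sym z≡x) x≢z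
  strip x≢z (there z∈) = z∈

inserts : A → List A → List (List A)
inserts x []       = (x ∷ []) ∷ []
inserts x (y ∷ ys) = (x ∷ y ∷ ys) ∷ map (y ∷_) (inserts x ys)

perms : List A → List (List A)
perms []       = [] ∷ []
perms (x ∷ xs) = concatMap (inserts x) (perms xs)

length-inserts : ∀ (x : A) ys → length (inserts x ys) ≡ suc (length ys)
length-inserts x []       = refl
length-inserts x (y ∷ ys) = cong suc (trans (length-map (y ∷_) (inserts x ys)) (length-inserts x ys))

inserts-length : ∀ (x : A) ys → All (λ zs → length zs ≡ suc (length ys)) (inserts x ys)
inserts-length x []       = refl ∷ []
inserts-length x (y ∷ ys) = refl ∷ All.map⁺ (All.map (cong suc) (inserts-length x ys))

perms-length : ∀ (xs : List A) → All (λ ys → length ys ≡ length xs) (perms xs)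
perms-length []       = refl ∷ []
perms-length (x ∷ xs) = All.concat⁺ (All.map⁺ (All.map
  (λ {ys} eq → All.map (λ e → trans e (cong suc eq)) (inserts-length x ys)) (perms-length xs)))

length-perms : ∀ (xs : List A) → length (perms xs) ≡ length xs !
length-perms []       = refl
length-perms (x ∷ xs) = trans
  (length-concatMap (inserts x) (All.map (λ {ys} eq → trans (length-inserts x ys) (cong suc eq)) (perms-length xs)))
  (trans (cong (ℕ._* suc (length xs)) (length-perms xs)) (ℕ.*-comm (length xs !) (suc (length xs))))

∈-inserts : ∀ (x : A) ps qs → ps ++ x ∷ qs ∈ inserts x (ps ++ qs)
∈-inserts x []       []       = here refl
∈-inserts x []       (q ∷ qs) = here refl
∈-inserts x (p ∷ ps) qs       = there (∈-map⁺ (p ∷_) (∈-inserts x ps qs))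

∈-perms : ∀ {xs ys : List A} → ys ↭ xs → ys ∈ perms xs
∈-perms {xs = []}     ys↭ with refl ← ↭-empty-inv ys↭ = here refl
∈-perms {xs = x ∷ xs} ys↭ with ∈-∃++ (∈-resp-↭ (↭-sym ys↭) (here refl))
... | ps , qs , refl = ∈-concatMap⁺ (inserts x)
  (Any.map (λ { refl → ∈-inserts x ps qs }) (∈-perms (drop-∷ (↭-trans (↭-sym (↭.shift x ps qs)) ys↭))))

-- With `vs` the entries of v, `select₀` gives those paired with the smallest letter and `select₁`
-- those left for the larger letters.
select₀ select₁ : ∀ {a b} → Pat a b → List A → List A
select₀ []     vs       = []
select₀ (o∷ p) []       = []
select₀ (o∷ p) (v ∷ vs) = v ∷ select₀ p vs
select₀ (i∷ p) []       = []
select₀ (i∷ p) (v ∷ vs) = select₀ p vs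
select₁ []     vs       = []
select₁ (o∷ p) []       = []
select₁ (o∷ p) (v ∷ vs) = select₁ p vs
select₁ (i∷ p) []       = []
select₁ (i∷ p) (v ∷ vs) = v ∷ select₁ p vs

length-select₀ : ∀ {a b} (p : Pat a b) (vs : List A) → length vs ≡ a ℕ.+ b → length (select₀ p vs) ≡ a
length-select₀ []                 vs       eq = refl
length-select₀ (o∷ p)             (v ∷ vs) eq = cong suc (length-select₀ p vs (ℕ.suc-injective eq))
length-select₀ (i∷_ {a} {b} p)    []       eq = contradiction (trans eq (ℕ.+-suc a b)) λ ()
length-select₀ (i∷_ {a} {b} p)    (v ∷ vs) eq = length-select₀ p vs (ℕ.suc-injective (trans eq (ℕ.+-suc a b)))

length-select₁ : ∀ {a b} (p : Pat a b) (vs : List A) → length vs ≡ a ℕ.+ b → length (select₁ p vs) ≡ b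
length-select₁ []                 vs       eq = refl
length-select₁ (o∷ p)             (v ∷ vs) eq = length-select₁ p vs (ℕ.suc-injective eq)
length-select₁ (i∷_ {a} {b} p)    []       eq = contradiction (trans eq (ℕ.+-suc a b)) λ ()
length-select₁ (i∷_ {a} {b} p)    (v ∷ vs) eq = cong suc (length-select₁ p vs (ℕ.suc-injective (trans eq (ℕ.+-suc a b))))

select₁-All : ∀ {ℓ′} {P : A → Set ℓ′} {a b} (p : Pat a b) {vs} → All P vs → All P (select₁ p vs)
select₁-All []     _          = []
select₁-All (o∷ p) []         = []
select₁-All (o∷ p) (_  ∷ pvs) = select₁-All p pvs
select₁-All (i∷ p) []         = []
select₁-All (i∷ p) (pv ∷ pvs) = pv ∷ select₁-All p pvs

select₁-AllPairs : ∀ {ℓ′} {R : A → A → Set ℓ′} {a b} (p : Pat a b) {vs} → AllPairs R vs → AllPairs R (select₁ p vs)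
select₁-AllPairs []     _        = []
select₁-AllPairs (o∷ p) []       = []
select₁-AllPairs (o∷ p) (_ ∷ rs) = select₁-AllPairs p rs
select₁-AllPairs (i∷ p) []       = []
select₁-AllPairs (i∷ p) (r ∷ rs) = select₁-All p r ∷ select₁-AllPairs p rs

++-∷-↭ : ∀ (l : List A) {r v r′} → r ↭ v ∷ r′ → l ++ r ↭ v ∷ (l ++ r′)
++-∷-↭ l r↭ = ↭-trans (↭.++⁺ˡ l r↭) (↭.shift _ l _)

-- The pattern is read off along `vs`: the first entry occurs in `l` or in `r`, is removed there,
-- and the letter records which.
pattern-of : ∀ (vs : List A) {a b} l r → length l ≡ a → length r ≡ b → l ++ r ↭ vs →
             ∃ λ (p : Pat a b) → l ↭ select₀ p vs × r ↭ select₁ p vs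
pattern-of []       []      []      refl refl _   = [] , refl , refl
pattern-of []       []      (_ ∷ _) refl refl l++r↭ = contradiction (↭-length l++r↭) λ ()
pattern-of []       (_ ∷ _) _       refl refl l++r↭ = contradiction (↭-length l++r↭) λ ()
pattern-of (v ∷ vs) l r refl refl l++r↭ with ∈-++⁻ l (∈-resp-↭ (↭-sym l++r↭) (here refl))
... | inj₁ v∈l with l′ , l↭ ← ∈-∃↭ v∈l rewrite ↭-length l↭
  with p , l′↭ , r↭ ← pattern-of vs l′ r refl refl (drop-∷ (↭-trans (↭-sym (↭.++⁺ʳ r l↭)) l++r↭))
  = o∷ p , ↭-trans l↭ (prep v l′↭) , r↭
pattern-of (v ∷ vs) l r refl refl l++r↭ | inj₂ v∈r with r′ , r↭ ← ∈-∃↭ v∈r rewrite ↭-length r↭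
  with p , l↭ , r′↭ ← pattern-of vs l r′ refl refl (drop-∷ (↭-trans (↭-sym (++-∷-↭ l r↭)) l++r↭))
  = i∷ p , l↭ , ↭-trans r↭ (prep v r′↭)

++-split : ∀ a {b} (l : List A) → length l ≡ a ℕ.+ b → ∃₂ λ l₀ l₁ → l ≡ l₀ ++ l₁ × length l₀ ≡ a × length l₁ ≡ b
++-split zero    l       eq = [] , l , refl , refl , eq
++-split (suc a) (x ∷ l) eq with ++-split a l (ℕ.suc-injective eq)
... | l₀ , l₁ , refl , refl , len₁ = x ∷ l₀ , l₁ , refl , refl , len₁

-- Lays `vs` out against the sorted letters, block by block. The word fixes which entries go to each
-- block, and only the order inside the blocks is free; this is the source of the factor α!.
realize : ∀ α → Word α → List A → List (List A)
realize []      _       vs = [] ∷ []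
realize (a ∷ α) (p , x) vs = cartesianProductWith _++_ (perms (select₀ p vs)) (realize α x (select₁ p vs))

length-realize : ∀ α (x : Word α) (vs : List A) → length vs ≡ sum α → length (realize α x vs) ≡ compFact α
length-realize []      x       vs eq = refl
length-realize (a ∷ α) (p , x) vs eq = trans
  (length-cartesianProductWith _++_ (perms (select₀ p vs)) (realize α x (select₁ p vs)))
  (cong₂ ℕ._*_ (trans (length-perms (select₀ p vs)) (cong _! (length-select₀ p vs eq)))
    (length-realize α x (select₁ p vs) (length-select₁ p vs eq)))

-- Carries a list along a permutation of another list, position by position.
move : ∀ {ℓ′} {B : Set ℓ′} {xs ys : List A} → xs ↭ ys → List B → List B
move refl           l           = l
move (prep _ p)     []          = []
move (prep _ p)     (x ∷ l)     = x ∷ move p l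
move (swap _ _ p)   (x ∷ y ∷ l) = y ∷ x ∷ move p l
move (swap _ _ p)   l           = l
move (p ⨾ q)    l           = move q (move p l)

move-↭ : ∀ {ℓ′} {B : Set ℓ′} {xs ys : List A} (p : xs ↭ ys) (l : List B) → move p l ↭ l
move-↭ refl           l           = refl
move-↭ (prep _ p)     []          = refl
move-↭ (prep _ p)     (x ∷ l)     = prep x (move-↭ p l)
move-↭ (swap _ _ p)   []          = refl
move-↭ (swap _ _ p)   (x ∷ [])    = refl
move-↭ (swap _ _ p)   (x ∷ y ∷ l) = swap y x (move-↭ p l)
move-↭ (p ⨾ q)    l           = move-↭ q (move p l) ⨾ move-↭ p l

move-injective : ∀ {ℓ′} {B : Set ℓ′} {xs ys : List A} (p : xs ↭ ys) {l l′ : List B} → move p l ≡ move p l′ → l ≡ l′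
move-injective refl                                   eq   = eq
move-injective (prep _ p) {[]}        {[]}            eq   = refl
move-injective (prep _ p) {x ∷ l}     {y ∷ l′}        eq   =
  cong₂ _∷_ (∷-injectiveˡ eq) (move-injective p (∷-injectiveʳ eq))
move-injective (swap _ _ p) {[]}      {[]}            eq   = refl
move-injective (swap _ _ p) {[]}      {_ ∷ []}        ()
move-injective (swap _ _ p) {[]}      {_ ∷ _ ∷ _}     ()
move-injective (swap _ _ p) {_ ∷ []}  {[]}            ()
move-injective (swap _ _ p) {_ ∷ []}  {_ ∷ []}        eq   = eq
move-injective (swap _ _ p) {_ ∷ []}  {_ ∷ _ ∷ _}     ()
move-injective (swap _ _ p) {_ ∷ _ ∷ _} {[]}          ()
move-injective (swap _ _ p) {_ ∷ _ ∷ _} {_ ∷ []}      ()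
move-injective (swap _ _ p) {x ∷ y ∷ l} {x′ ∷ y′ ∷ l′} eq  =
  cong₂ _∷_ (∷-injectiveˡ (∷-injectiveʳ eq))
    (cong₂ _∷_ (∷-injectiveˡ eq) (move-injective p (∷-injectiveʳ (∷-injectiveʳ eq))))
move-injective (p ⨾ q)                                eq   = move-injective p (move-injective q eq)

-- Dot products over an ordered field

module _ {c} (F : OrderedField c) where

  open OrderedField F using (Carrier; _<_; 0#; compare; +-mono-<; *-pos; isStrictTotalOrder; isCommutativeRing)
    renaming (_+_ to infixl 6 _⊹_; _*_ to infixl 7 _·_; -_ to infix 8 ⊖_)

  private
    R : CommutativeRing c c
    R = record { isCommutativeRing = isCommutativeRing }

    module R = CommutativeRing R
    module < = IsStrictTotalOrder isStrictTotalOrder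

    Seq : Set c
    Seq = List Carrier

  infix 4 _≼_ _⊏_

  _≼_ : Carrier → Carrier → Set c
  x ≼ y = x < y ⊎ x ≡ y

  ≼-trans : ∀ {x y z} → x ≼ y → y ≼ z → x ≼ z
  ≼-trans (inj₁ x<y) (inj₁ y<z)  = inj₁ (<.trans x<y y<z)
  ≼-trans (inj₁ x<y) (inj₂ refl) = inj₁ x<y
  ≼-trans (inj₂ refl) y≼z        = y≼z

  ⊹-monoʳ-< : ∀ z {x y} → x < y → z ⊹ x < z ⊹ y
  ⊹-monoʳ-< z x<y = subst₂ _<_ (R.+-comm _ z) (R.+-comm _ z) (+-mono-< z x<y)

  ⊹-mono-<-≼ : ∀ {x y z w} → x < y → z ≼ w → x ⊹ z < y ⊹ w
  ⊹-mono-<-≼ {z = z} x<y (inj₁ z<w)  = <.trans (+-mono-< z x<y) (⊹-monoʳ-< _ z<w)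
  ⊹-mono-<-≼ {z = z} x<y (inj₂ refl) = +-mono-< z x<y

  x<y⇒0<y⊖x : ∀ {x y} → x < y → 0# < y ⊹ ⊖ x
  x<y⇒0<y⊖x {x} x<y = subst (_< _) (R.-‿inverseʳ x) (+-mono-< (⊖ x) x<y)

  x⊹[y⊖x]≡y : ∀ x y → x ⊹ (y ⊹ ⊖ x) ≡ y
  x⊹[y⊖x]≡y x y = begin
    x ⊹ (y ⊹ ⊖ x)   ≡⟨ R.+-comm x _ ⟩
    y ⊹ ⊖ x ⊹ x     ≡⟨ R.+-assoc y _ x ⟩
    y ⊹ (⊖ x ⊹ x)   ≡⟨ cong (λ z → y ⊹ z) (R.-‿inverseˡ x) ⟩
    y ⊹ 0#           ≡⟨ R.+-identityʳ y ⟩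
    y                ∎
    where open ≡-Reasoning

  ·-monoʳ-< : ∀ {d x y} → 0# < d → x < y → d · x < d · y
  ·-monoʳ-< {d} {x} {y} 0<d x<y = subst₂ _<_ (R.+-identityʳ (d · x))
    (trans (sym (R.distribˡ d x _)) (cong (d ·_) (x⊹[y⊖x]≡y x y)))
    (⊹-monoʳ-< (d · x) (*-pos 0<d (x<y⇒0<y⊖x x<y)))

  total : Seq → Carrier
  total []       = 0#
  total (x ∷ xs) = x ⊹ total xs

  total-↭ : ∀ {xs ys} → xs ↭ ys → total xs ≡ total ys
  total-↭ refl         = refl
  total-↭ (prep x p)   = cong (x ⊹_) (total-↭ p)
  total-↭ (swap {xs} {ys} x y p) = begin
    x ⊹ (y ⊹ total xs)   ≡⟨ R.+-assoc x y _ ⟨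
    x ⊹ y ⊹ total xs     ≡⟨ cong₂ _⊹_ (R.+-comm x y) (total-↭ p) ⟩
    y ⊹ x ⊹ total ys     ≡⟨ R.+-assoc y x _ ⟩
    y ⊹ (x ⊹ total ys)   ∎
    where open ≡-Reasoning
  total-↭ (p ⨾ q)      = trans (total-↭ p) (total-↭ q)

  total-select : ∀ {a b} (p : Pat a b) vs → length vs ≡ a ℕ.+ b → total vs ≡ total (select₀ p vs) ⊹ total (select₁ p vs)
  total-select []              []       eq = sym (R.+-identityʳ 0#)
  total-select (o∷ p)          (v ∷ vs) eq =
    trans (cong (v ⊹_) (total-select p vs (ℕ.suc-injective eq))) (sym (R.+-assoc v _ _))
  total-select (i∷_ {a} {b} p) []       eq = contradiction (trans eq (ℕ.+-suc a b)) λ ()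
  total-select (i∷_ {a} {b} p) (v ∷ vs) eq = begin
    v ⊹ total vs       ≡⟨ cong (v ⊹_) (total-select p vs (ℕ.suc-injective (trans eq (ℕ.+-suc a b)))) ⟩
    v ⊹ (s₀ ⊹ s₁)      ≡⟨ R.+-assoc v s₀ s₁ ⟨
    v ⊹ s₀ ⊹ s₁        ≡⟨ cong (_⊹ s₁) (R.+-comm v s₀) ⟩
    s₀ ⊹ v ⊹ s₁        ≡⟨ R.+-assoc s₀ v s₁ ⟩
    s₀ ⊹ (v ⊹ s₁)      ∎
    where
    open ≡-Reasoning
    s₀ = total (select₀ p vs)
    s₁ = total (select₁ p vs)

  -- The effect of a single cover on the sublists of `vs`: exactly one entry grows, the others stay
  -- in place.
  data _⊏_ : Seq → Seq → Set c where
    here  : ∀ {x y xs} → x < y → x ∷ xs ⊏ y ∷ xs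
    there : ∀ {x xs ys} → xs ⊏ ys → x ∷ xs ⊏ x ∷ ys

  total-⊏ : ∀ {xs ys} → xs ⊏ ys → total xs < total ys
  total-⊏ (here x<y)            = +-mono-< _ x<y
  total-⊏ (there {x} xs⊏ys) = ⊹-monoʳ-< x (total-⊏ xs⊏ys)

  select₁-⊏ : ∀ {a b} (p : Pat a b) {xs ys} → xs ⊏ ys → select₁ p xs ⊏ select₁ p ys ⊎ select₁ p xs ≡ select₁ p ys
  select₁-⊏ []     _             = inj₂ refl
  select₁-⊏ (o∷ p) (here _)      = inj₂ refl
  select₁-⊏ (o∷ p) (there xs⊏ys) = select₁-⊏ p xs⊏ys
  select₁-⊏ (i∷ p) (here x<y)    = inj₁ (here x<y)
  select₁-⊏ (i∷ p) (there {x} xs⊏ys) with select₁-⊏ p xs⊏ys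
  ... | inj₁ ⊏′ = inj₁ (there ⊏′)
  ... | inj₂ eq = inj₂ (cong (x ∷_) eq)

  Increasing : Seq → Set c
  Increasing = AllPairs _<_

  -- An exchange of `o i` into `i o` at neighbouring entries v < w hands the `i` from w to v, so one
  -- entry of the selected sublist shrinks.
  patDown-⊏ : ∀ {a b} (p : Pat a b) vs → length vs ≡ a ℕ.+ b → Increasing vs →
              Over (λ q → select₁ q vs ⊏ select₁ p vs) (patDown p)
  patDown-⊏ []               vs       eq inc        = []
  patDown-⊏ (o∷ p)           (v ∷ vs) eq (v< ∷ inc) =
    All.++⁺ (raised p vs (ℕ.suc-injective eq) v<) (over-cmap id (patDown-⊏ p vs (ℕ.suc-injective eq) inc))
    where
    raised : ∀ {a b} (p : Pat a b) vs → length vs ≡ a ℕ.+ b → All (v <_) vs →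
             Over (λ q → select₁ q (v ∷ vs) ⊏ select₁ p vs) (raise p)
    raised []              vs       eq v<       = []
    raised (o∷ p)          vs       eq v<       = []
    raised (i∷_ {a} {b} p) []       eq v<       = contradiction (trans eq (ℕ.+-suc a b)) λ ()
    raised (i∷ p)          (w ∷ vs) eq (v<w ∷ _) = here v<w ∷ []
  patDown-⊏ (i∷_ {a} {b} p)  []       eq inc        = contradiction (trans eq (ℕ.+-suc a b)) λ ()
  patDown-⊏ (i∷_ {a} {b} p)  (v ∷ vs) eq (_ ∷ inc)  =
    over-cmap there (patDown-⊏ p vs (ℕ.suc-injective (trans eq (ℕ.+-suc a b))) inc)

  Gaps : List ℕ → Set c
  Gaps α = Vec Carrier (length α)

  Positive : ∀ {n} → Vec Carrier n → Set c
  Positive = VecAll.All (0# <_)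

  -- The first gap leads from 0 to the smallest letter and may have any sign; the later gaps
  -- separate distinct letters.
  PositiveTail : ∀ {n} → Vec Carrier n → Set c
  PositiveTail []       = Level.Lift c ⊤
  PositiveTail (_ ∷ ds) = Positive ds

  -- By Abel summation, the dot product of a word with vs is a combination of totals of
  -- sublists of vs whose coefficients are the gaps between consecutive letters.
  value : ∀ α → Gaps α → Word α → Seq → Carrier
  value []      []       x       vs = 0#
  value (a ∷ α) (d ∷ ds) (p , x) vs = d · total vs ⊹ value α ds x (select₁ p vs)

  value-≼ : ∀ α {ds} → Positive ds → ∀ x {vs vs′} → vs ⊏ vs′ ⊎ vs ≡ vs′ → value α ds x vs ≼ value α ds x vs′
  value-⊏ : ∀ a α {ds} → Positive ds → ∀ x {vs vs′} → vs ⊏ vs′ → value (a ∷ α) ds x vs < value (a ∷ α) ds x vs′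

  value-≼ α       ds⁺ x (inj₂ refl) = inj₂ refl
  value-≼ []      []  x (inj₁ ⊏′)   = inj₂ refl
  value-≼ (a ∷ α) ds⁺ x (inj₁ ⊏′)   = inj₁ (value-⊏ a α ds⁺ x ⊏′)

  value-⊏ a α (0<d ∷ ds⁺) (p , x) ⊏′ =
    ⊹-mono-<-≼ (·-monoʳ-< 0<d (total-⊏ ⊏′)) (value-≼ α ds⁺ x (select₁-⊏ p ⊏′))

  -- Strictness needs a larger letter to carry a positive gap. If there is none, the selected
  -- sublist is empty and no entry can shrink.
  value-tail-⊏ : ∀ α {ds} → Positive ds → ∀ x {a} {p q : Pat a (sum α)} {vs} →
                 select₁ q vs ⊏ select₁ p vs → value α ds x (select₁ q vs) < value α ds x (select₁ p vs)
  value-tail-⊏ []      ds⁺ x {q = q} {vs} ⊏′ = contradiction (subst (_⊏ _) (select₁-none q vs) ⊏′) λ ()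
    where
    select₁-none : ∀ {a} (p : Pat a 0) (vs : Seq) → select₁ p vs ≡ []
    select₁-none []     vs       = refl
    select₁-none (o∷ p) []       = refl
    select₁-none (o∷ p) (v ∷ vs) = select₁-none p vs
  value-tail-⊏ (a ∷ α) ds⁺ x ⊏′ = value-⊏ a α ds⁺ x ⊏′

  positive⇒positiveTail : ∀ {n} {ds : Vec Carrier n} → Positive ds → PositiveTail ds
  positive⇒positiveTail []        = Level.lift tt
  positive⇒positiveTail (_ ∷ ds⁺) = ds⁺

  -- A cover changes either the first pattern or a later one. Both keep `d · total vs`, which only
  -- sees the whole list, so the comparison takes place in the remaining terms.
  value-descends : ∀ α {ds} → PositiveTail ds → ∀ vs → length vs ≡ sum α → Increasing vs → ∀ x →
                   Over (λ y → value α ds y vs < value α ds x vs) (Rep.down (wordRep α) x)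
  value-descends []                 ds⁺ vs eq inc x       = []
  value-descends (a ∷ α) {d ∷ ds} ds⁺ vs eq inc (p , x) = All.++⁺
    (over-cmap (λ {q} ⊏′ → ⊹-monoʳ-< _ (value-tail-⊏ α ds⁺ x {p = p} {q} {vs} ⊏′)) (patDown-⊏ p vs eq inc))
    (over-cmap (⊹-monoʳ-< _)
      (value-descends α (positive⇒positiveTail ds⁺) (select₁ p vs) (length-select₁ p vs eq) (select₁-AllPairs p inc) x))

  expand : ∀ α → Gaps α → Carrier → Seq
  expand []      []       u = []
  expand (a ∷ α) (d ∷ ds) u = replicate a (u ⊹ d) ++ expand α ds (u ⊹ d)

  dotL : Seq → Seq → Carrier
  dotL []       _        = 0#
  dotL (_ ∷ _)  []       = 0#
  dotL (w ∷ ws) (v ∷ vs) = w · v ⊹ dotL ws vs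

  dotL-replicate : ∀ u ws l r → dotL (replicate (length l) u ++ ws) (l ++ r) ≡ u · total l ⊹ dotL ws r
  dotL-replicate u ws []      r = sym (trans (cong (_⊹ dotL ws r) (R.zeroʳ u)) (R.+-identityˡ _))
  dotL-replicate u ws (x ∷ l) r = begin
    u · x ⊹ dotL (replicate (length l) u ++ ws) (l ++ r)   ≡⟨ cong (λ z → u · x ⊹ z) (dotL-replicate u ws l r) ⟩
    u · x ⊹ (u · total l ⊹ dotL ws r)                      ≡⟨ R.+-assoc (u · x) _ _ ⟨
    u · x ⊹ u · total l ⊹ dotL ws r                        ≡⟨ cong (_⊹ dotL ws r) (R.distribˡ u x _) ⟨
    u · total (x ∷ l) ⊹ dotL ws r                          ∎
    where open ≡-Reasoning

  -- Here `u` is the letter before the current block. All entries left over pay at least the letter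
  -- `u ⊹ d`, so `d` multiplies the total of all of `vs`, and the rest of the word starts again from
  -- `u ⊹ d`.
  realize-complete : ∀ α (ds : Gaps α) u {vs l} → length vs ≡ sum α → l ↭ vs →
                     ∃ λ x → l ∈ realize α x vs × dotL (expand α ds u) l ≡ u · total vs ⊹ value α ds x vs
  realize-complete []      []       u {[]} eq l↭ with refl ← ↭-empty-inv l↭ =
    tt , here refl , sym (trans (R.+-identityʳ _) (R.zeroʳ u))
  realize-complete (a ∷ α) (d ∷ ds) u {vs} {l} eq l↭
    with l₀ , l₁ , refl , len₀ , len₁ ← ++-split a l (trans (↭-length l↭) eq)
    with p , l₀↭ , l₁↭ ← pattern-of vs l₀ l₁ len₀ len₁ l↭
    with x , l₁∈ , eq₁ ← realize-complete α ds (u ⊹ d) (length-select₁ p vs eq) l₁↭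
    with refl ← len₀ =
    (p , x) , ∈-cartesianProductWith⁺ _++_ (∈-perms l₀↭) l₁∈ , (begin
      dotL (replicate (length l₀) (u ⊹ d) ++ expand α ds (u ⊹ d)) (l₀ ++ l₁)
        ≡⟨ dotL-replicate (u ⊹ d) _ l₀ l₁ ⟩
      (u ⊹ d) · total l₀ ⊹ dotL (expand α ds (u ⊹ d)) l₁
        ≡⟨ cong₂ _⊹_ (cong ((u ⊹ d) ·_) (total-↭ l₀↭)) eq₁ ⟩
      (u ⊹ d) · s₀ ⊹ ((u ⊹ d) · s₁ ⊹ val)
        ≡⟨ R.+-assoc ((u ⊹ d) · s₀) _ val ⟨
      (u ⊹ d) · s₀ ⊹ (u ⊹ d) · s₁ ⊹ val
        ≡⟨ cong (_⊹ val) (trans (sym (R.distribˡ (u ⊹ d) s₀ s₁)) (cong ((u ⊹ d) ·_) (sym (total-select p vs eq)))) ⟩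
      (u ⊹ d) · total vs ⊹ val
        ≡⟨ cong (_⊹ val) (R.distribʳ (total vs) u d) ⟩
      u · total vs ⊹ d · total vs ⊹ val
        ≡⟨ R.+-assoc (u · total vs) _ val ⟩
      u · total vs ⊹ (d · total vs ⊹ val) ∎)
    where
    open ≡-Reasoning
    s₀ = total (select₀ p vs)
    s₁ = total (select₁ p vs)
    val = value α ds x (select₁ p vs)

  -- Sorting and the blocks of equal entries

  insert-↭ : ∀ x ys → insert F x ys ↭ x ∷ ys
  insert-↭ x []       = refl
  insert-↭ x (y ∷ ys) with compare x y
  ... | tri< _ _ _ = refl
  ... | tri≈ _ _ _ = refl
  ... | tri> _ _ _ = prep y (insert-↭ x ys) ⨾ swap y x refl

  sortL-↭ : ∀ xs → sortL F xs ↭ xs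
  sortL-↭ []       = refl
  sortL-↭ (x ∷ xs) = insert-↭ x (sortL F xs) ⨾ prep x (sortL-↭ xs)

  Sorted : Seq → Set c
  Sorted = AllPairs _≼_

  insert-sorted : ∀ x {ys} → Sorted ys → Sorted (insert F x ys)
  insert-sorted x {[]}     []          = [] ∷ []
  insert-sorted x {y ∷ ys} (y≼ ∷ sorted) with compare x y
  ... | tri< x<y _ _ = (inj₁ x<y ∷ All.map (≼-trans (inj₁ x<y)) y≼) ∷ y≼ ∷ sorted
  ... | tri≈ _ x≡y _ = (inj₂ x≡y ∷ All.map (≼-trans (inj₂ x≡y)) y≼) ∷ y≼ ∷ sorted
  ... | tri> _ _ y<x = All-resp-↭ (↭-sym (insert-↭ x ys)) (inj₁ y<x ∷ y≼) ∷ insert-sorted x sorted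

  sortL-sorted : ∀ xs → Sorted (sortL F xs)
  sortL-sorted []       = []
  sortL-sorted (x ∷ xs) = insert-sorted x (sortL-sorted xs)

  sortL-increasing : ∀ {xs} → Unique xs → Increasing (sortL F xs)
  sortL-increasing {xs} uniq = AllPairs.zipWith
    (λ { (inj₁ x<y , _) → x<y ; (inj₂ x≡y , x≢y) → contradiction x≡y x≢y })
    (sortL-sorted xs , ↭ₛ.Unique-resp-↭ (setoid Carrier) (↭⇒↭ₛ (↭-sym (sortL-↭ xs))) uniq)

  replicate-∷ : ∀ k (x : Carrier) ys → replicate k x ++ x ∷ ys ≡ x ∷ replicate k x ++ ys
  replicate-∷ zero    x ys = refl
  replicate-∷ (suc k) x ys = cong (x ∷_) (replicate-∷ k x ys)

  -- The `k` copies of `x` are the part of the current run already read, and `a` is its final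
  -- length. The gaps concern only the jumps after this run, hence all are positive.
  expand-runsFrom : ∀ x k ys → Sorted (x ∷ ys) → ∃₂ λ a α → Σ (Gaps α) λ ds →
    runsFrom F x k ys ≡ a ∷ α × Positive ds × replicate a x ++ expand α ds x ≡ replicate k x ++ ys
  expand-runsFrom x k []       _ = k , [] , [] , refl , [] , refl
  expand-runsFrom x k (y ∷ ys) ((x≼y ∷ x≼) ∷ sorted) with compare x y
  ... | tri≈ _ refl _ with a , α , ds , runs≡ , ds⁺ , eq ← expand-runsFrom x (suc k) ys (x≼ ∷ AllPairs.tail sorted) =
    a , α , ds , runs≡ , ds⁺ , trans eq (sym (replicate-∷ k x ys))
  ... | tri< x<y _ _ with a , α , ds , runs≡ , ds⁺ , eq ← expand-runsFrom y 1 ys sorted =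
    k , a ∷ α , y ⊹ ⊖ x ∷ ds , cong (k ∷_) runs≡ , x<y⇒0<y⊖x x<y ∷ ds⁺ ,
    cong (replicate k x ++_) (trans (cong (λ z → replicate a z ++ expand α ds z) (x⊹[y⊖x]≡y x y)) eq)
  ... | tri> x≮y x≢y _ with x≼y
  ...   | inj₁ x<y = contradiction x<y x≮y
  ...   | inj₂ x≡y = contradiction x≡y x≢y

  expand-runs : ∀ ws → Sorted ws → Σ (Gaps (runs F ws)) λ ds → PositiveTail ds × expand (runs F ws) ds 0# ≡ ws
  expand-runs []       _      = [] , Level.lift tt , refl
  expand-runs (x ∷ ws) sorted with runsFrom F x 1 ws | expand-runsFrom x 1 ws sorted
  ... | _ | a , α , ds , refl , ds⁺ , eq =
    x ∷ ds , ds⁺ , trans (cong (λ z → replicate a z ++ expand α ds z) (R.+-identityˡ x)) eq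

  sum-runsFrom : ∀ x k ys → sum (runsFrom F x k ys) ≡ k ℕ.+ length ys
  sum-runsFrom x k []       = refl
  sum-runsFrom x k (y ∷ ys) with compare x y
  ... | tri≈ _ _ _ = trans (sum-runsFrom x (suc k) ys) (sym (ℕ.+-suc k _))
  ... | tri< _ _ _ = cong (k ℕ.+_) (sum-runsFrom y 1 ys)
  ... | tri> _ _ _ = cong (k ℕ.+_) (sum-runsFrom y 1 ys)

  sum-runs : ∀ ws → sum (runs F ws) ≡ length ws
  sum-runs []       = refl
  sum-runs (x ∷ ws) = sum-runsFrom x 1 ws

  sum-comp : ∀ {n} (w : Fin n → Carrier) → sum (comp F w) ≡ n
  sum-comp w = trans (sum-runs (sortL F (toList w))) (trans (↭-length (sortL-↭ (toList w))) (length-tabulate w))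

  -- From permutations to arrangements of the entries

  dot≡dotL : ∀ {n} (w v : Fin n → Carrier) → dot F w v ≡ dotL (toList w) (toList v)
  dot≡dotL {zero}  w v = refl
  dot≡dotL {suc n} w v = cong (λ z → w zero · v zero ⊹ z) (dot≡dotL (w ∘ suc) (v ∘ suc))

  dotL-move : ∀ {ws ws′} (p : ws ↭ ws′) l → length l ≡ length ws → dotL ws′ (move p l) ≡ dotL ws l
  dotL-move refl         l           eq = refl
  dotL-move (prep w p)   (x ∷ l)     eq = cong (λ z → w · x ⊹ z) (dotL-move p l (ℕ.suc-injective eq))
  dotL-move (swap {ws} {ws′} w w′ p) (x ∷ y ∷ l) eq = begin
    w′ · y ⊹ (w · x ⊹ dotL ws′ (move p l))   ≡⟨ R.+-assoc (w′ · y) _ _ ⟨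
    w′ · y ⊹ w · x ⊹ dotL ws′ (move p l)     ≡⟨ cong₂ _⊹_ (R.+-comm (w′ · y) _)
                                                  (dotL-move p l (ℕ.suc-injective (ℕ.suc-injective eq))) ⟩
    w · x ⊹ w′ · y ⊹ dotL ws l               ≡⟨ R.+-assoc (w · x) _ _ ⟩
    w · x ⊹ (w′ · y ⊹ dotL ws l)             ∎
    where open ≡-Reasoning
  dotL-move (p ⨾ q)      l           eq = trans
    (dotL-move q (move p l) (trans (↭-length (move-↭ p l)) (trans eq (↭-length p)))) (dotL-move p l eq)

  -- Both lists are free of repetitions because `v` is injective, so having the same members makes
  -- them rearrangements of each other.
  act-↭ : ∀ {n} (v : Fin n → Carrier) → (∀ i j → v i ≡ v j → i ≡ j) → ∀ σ → toList (act F σ v) ↭ toList v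
  act-↭ v inj σ = ∼bag⇒↭ (unique∧set⇒bag
    (Unique.tabulate⁺ λ {i} {j} eq → trans (sym (inverseʳ σ)) (trans (cong (σ ⟨$⟩ʳ_) (inj _ _ eq)) (inverseʳ σ)))
    (Unique.tabulate⁺ λ {i} {j} → inj i j)
    (mk⇔ to from))
    where
    to : ∀ {x} → x ∈ toList (act F σ v) → x ∈ toList v
    to x∈ with i , refl ← ∈-tabulate⁻ x∈ = ∈-tabulate⁺ (σ ⟨$⟩ˡ i)
    from : ∀ {x} → x ∈ toList v → x ∈ toList (act F σ v)
    from x∈ with i , refl ← ∈-tabulate⁻ x∈ =
      subst (λ j → v j ∈ toList (act F σ v)) (inverseˡ σ) (∈-tabulate⁺ {f = act F σ v} (σ ⟨$⟩ʳ i))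

  act-injective : ∀ {n} (v : Fin n → Carrier) → (∀ i j → v i ≡ v j → i ≡ j) →
                  ∀ σ τ → toList (act F σ v) ≡ toList (act F τ v) → σ ≈ τ
  act-injective v inj σ τ eq i = begin
    σ ⟨$⟩ʳ i                       ≡⟨ inverseʳ τ ⟨
    τ ⟨$⟩ʳ (τ ⟨$⟩ˡ (σ ⟨$⟩ʳ i))    ≡⟨ cong (τ ⟨$⟩ʳ_) (inj _ _ (tabulate-injective _ _ eq (σ ⟨$⟩ʳ i))) ⟨
    τ ⟨$⟩ʳ (σ ⟨$⟩ˡ (σ ⟨$⟩ʳ i))    ≡⟨ cong (τ ⟨$⟩ʳ_) (inverseˡ σ) ⟩
    τ ⟨$⟩ʳ i                       ∎
    where
    open ≡-Reasoning
    tabulate-injective : ∀ {n} (f g : Fin n → Carrier) → toList f ≡ toList g → ∀ i → f i ≡ g i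
    tabulate-injective f g eq zero    = ∷-injectiveˡ eq
    tabulate-injective f g eq (suc i) = tabulate-injective (f ∘ suc) (g ∘ suc) (∷-injectiveʳ eq) i

  signOf : Carrier → Sign
  signOf x with compare x 0#
  ... | tri< _ _ _ = neg
  ... | tri≈ _ _ _ = null
  ... | tri> _ _ _ = pos

  signOf-0 : ∀ {x} → x ≡ 0# → signOf x ≡ null
  signOf-0 {x} x≡0 with compare x 0#
  ... | tri< _ x≢0 _ = contradiction x≡0 x≢0
  ... | tri≈ _ _ _   = refl
  ... | tri> _ x≢0 _ = contradiction x≡0 x≢0

  signOf-< : ∀ {x y} → y < x → signOf x ≢ pos → signOf y ≡ neg
  signOf-< {x} {y} y<x x≯0 with compare x 0# | compare y 0#
  ... | _              | tri< _ _ _   = refl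
  ... | tri< x<0 _ _   | tri≈ y≮0 _ _ = contradiction (<.trans y<x x<0) y≮0
  ... | tri≈ _ refl _  | tri≈ y≮0 _ _ = contradiction y<x y≮0
  ... | tri< x<0 _ _   | tri> y≮0 _ _ = contradiction (<.trans y<x x<0) y≮0
  ... | tri≈ _ refl _  | tri> y≮0 _ _ = contradiction y<x y≮0
  ... | tri> _ _ _     | _            = contradiction refl x≯0

  module _ {n} (v w : Fin n → Carrier) (v-injective : ∀ i j → v i ≡ v j → i ≡ j)
           {P} (isQMultinomial : IsQMultinomial n (comp F w) P)
           (σs : List (Permutation′ n)) (distinct : AllPairs (λ σ τ → ¬ (σ ≈ τ)) σs)
           (orthogonal : All (λ σ → dot F w (act F σ v) ≡ 0#) σs) where

    private
      α = comp F w
      vs = sortL F (toList v)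
      w-sort = ↭-sym (sortL-↭ (toList w))
      gaps = expand-runs (sortL F (toList w)) (sortL-sorted (toList w))
      ds = proj₁ gaps

      length-vs : length vs ≡ sum α
      length-vs = trans (↭-length (sortL-↭ (toList v))) (trans (length-tabulate v) (sym (sum-comp w)))

      open SL₂ (wordRep α)

      sign : Word α → Sign
      sign x = signOf (value α ds x vs)

      zeros : List (Word α)
      zeros = filter (λ x → sign x ≟ₛ null) elems

      zeros≤ : length zeros ℕ.≤ length (layer middle)
      zeros≤ = zeros≤layer sign λ x x≯0 → All.map (λ y<x → signOf-< y<x x≯0)
        (value-descends α (proj₁ (proj₂ gaps)) vs length-vs
          (sortL-increasing (Unique.tabulate⁺ λ {i} {j} → v-injective i j)) x)

      solutions : List Seq
      solutions = concatMap (λ x → realize α x vs) zeros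

      -- The entries of σv are carried along while `w` is sorted. This keeps the dot product and is
      -- injective, and puts the entries in the block order that `realize` produces.
      arrange : Permutation′ n → Seq
      arrange σ = move w-sort (toList (act F σ v))

      arrange-∈ : ∀ {σ} → dot F w (act F σ v) ≡ 0# → arrange σ ∈ solutions
      arrange-∈ {σ} dot≡0 with realize-complete α ds 0# length-vs
        (↭-trans (move-↭ w-sort _) (↭-trans (act-↭ v v-injective σ) (↭-sym (sortL-↭ (toList v)))))
      ... | x , ∈realize , dotL≡ = ∈-concatMap⁺ (λ x → realize α x vs)
        (Any.map (λ { refl → ∈realize }) (∈-filter⁺ (λ x → sign x ≟ₛ null) (complete x) (signOf-0 (begin
          value α ds x vs
            ≡⟨ R.+-identityˡ _ ⟨
          0# ⊹ value α ds x vs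
            ≡⟨ cong (_⊹ value α ds x vs) (R.zeroˡ (total vs)) ⟨
          0# · total vs ⊹ value α ds x vs
            ≡⟨ dotL≡ ⟨
          dotL (expand α ds 0#) (arrange σ)
            ≡⟨ cong (λ ws → dotL ws (arrange σ)) (proj₂ (proj₂ gaps)) ⟩
          dotL (sortL F (toList w)) (arrange σ)
            ≡⟨ dotL-move w-sort (toList (act F σ v)) (trans (length-tabulate (act F σ v)) (sym (length-tabulate w))) ⟩
          dotL (toList w) (toList (act F σ v))
            ≡⟨ dot≡dotL w (act F σ v) ⟨
          dot F w (act F σ v)
            ≡⟨ dot≡0 ⟩
          0# ∎))))
        where open ≡-Reasoning

      solutions-⊇ : ∀ {l} → l ∈ map arrange σs → l ∈ solutions
      solutions-⊇ l∈ with σ , σ∈ , refl ← ∈-map⁻ arrange l∈ = arrange-∈ {σ} (All.lookup orthogonal σ∈)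

      arrangements-unique : Unique (map arrange σs)
      arrangements-unique = AllPairs.map⁺ (AllPairs.map
        (λ {σ} {τ} σ≉τ eq → σ≉τ (act-injective v v-injective σ τ (move-injective w-sort eq))) distinct)

      -- Orthogonal permutations inject into the realizations of the `null` words. The list
      -- `solutions` may be longer than needed, as only an upper bound is wanted.
      count : length σs ℕ.≤ compFact α ℕ.* length (layer middle)
      count = begin
        length σs                    ≡⟨ length-map arrange σs ⟨
        length (map arrange σs)      ≤⟨ unique-⊆-length arrangements-unique solutions-⊇ ⟩
        length solutions             ≡⟨ length-concatMap (λ x → realize α x vs)
                                          (All.universal (λ x → length-realize α x vs length-vs) zeros) ⟩
        length zeros ℕ.* compFact α  ≡⟨ ℕ.*-comm (length zeros) _ ⟩
        compFact α ℕ.* length zeros  ≤⟨ ℕ.*-monoʳ-≤ (compFact α) zeros≤ ⟩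
        compFact α ℕ.* length (layer middle) ∎
        where open ℕ.≤-Reasoning

    orthogonal-count : + length σs ≤ + compFact α * M P
    orthogonal-count = begin
      + length σs
        ≤⟨ ℤ.+≤+ count ⟩
      + (compFact α ℕ.* length (layer middle))
        ≡⟨ ℤ.pos-* (compFact α) _ ⟩
      + compFact α * + length (layer middle)
        ≤⟨ ℤ.*-monoˡ-≤-nonNeg (+ compFact α)
             (layer-≤-M α {P} (subst (λ m → IsQMultinomial m α P) (sym (sum-comp w)) isQMultinomial) middle) ⟩
      + compFact α * M P ∎
      where open ℤ.≤-Reasoning

theorem2p2 : ∀ {c : Level} (F : OrderedField c) (n : ℕ)
    (v w : Fin n → OrderedField.Carrier F) →
    (∀ i j → v i ≡ v j → i ≡ j) →
    (P : Poly) → IsQMultinomial n (comp F w) P →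
    (σs : List (Permutation′ n)) →
    AllPairs (λ σ τ → ¬ (σ ≈ τ)) σs →
    All (λ σ → dot F w (act F σ v) ≡ OrderedField.0# F) σs →
    + (length σs) ≤ + (compFact (comp F w)) * M P
theorem2p2 F n v w v-injective P isQMultinomial σs distinct orthogonal =
  orthogonal-count F v w v-injective {P} isQMultinomial σs distinct orthogonal
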